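{- Let $\theta$ be a cost vector (the current reparameterization) for the current set of factors $\mathcal{F}$ and let $\varepsilon>0$. Let $\mathcal{G}$ be the signed partition graph defined by $\theta$ and $\varepsilon$. If $\mathcal{G}$ has a frustrated cycle, then the SAC tightening algorithm FindTriplets (with unbounded search depth), run with $\theta$ and $\varepsilon$, will find at least one node $r\in V$ with $\mathcal{L}_r=\mathcal{Y}_r$, and hence will output a set of triplets that yields a strict increase of the lower bound: if $\mathcal{F}'$ is obtained from $\mathcal{F}$ by adding the output triplets and $\theta$ is extended by zero to the new factors, then there is a reparameterization $\overline{\theta}$ of $\theta$ (with respect to $\mathcal{F}'$) with $\Phi(\overline{\theta})>\Phi(\theta)$.
   Context: **Factors and costs.** $V$ is a finite set of nodes; each $v\in V$ has a finite non-empty label set $\mathcal{X}_v$. For $\alpha\subseteq V$, $\mathcal{X}_\alpha=\prod_{v\in\alpha}\mathcal{X}_v$. The set of factors $\mathcal{F}$ consists of non-empty subsets of $V$ of size at most $3$; it contains all singletons $\{v\}$ (written $v$), a set $E$ of two-element factors (edges), and possibly triplets; all pairs contained in a triplet of $\mathcal{F}$ also belong to $\mathcal{F}$. A cost vector $\theta$ has components $\theta_\alpha(x_\alpha)\in\mathbb{R}$ for $\alpha\in\mathcal{F}$, $x_\alpha\in\mathcal{X}_\alpha$. The lower bound is $\Phi(\theta)=\sum_{\alpha}\min_{x_\alpha\in\mathcal{X}_\alpha}\theta_\alpha(x_\alpha)$, the sum being over all factors. **Reparameterizations.** For a set of factors $\mathcal{F}$ let $J=\{(\alpha,\beta):\alpha,\beta\in\mathcal{F},\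 \beta\subset\alpha,\ |\alpha|=|\beta|+1\}$. Given real numbers $\lambda_{\alpha\beta}(x_\beta)$ for $(\alpha,\beta)\in J$, $x_\beta\in\mathcal{X}_\beta$, define $$\theta^\lambda_\beta(x_\beta)=\theta_\beta(x_\beta)+\sum_{\alpha:(\alpha,\beta)\in J}\lambda_{\alpha\beta}(x_\beta)-\sum_{\gamma:(\beta,\gamma)\in J}\lambda_{\beta\gamma}(x_\gamma),$$ where $x_\gamma$ is the restriction of $x_\beta$ to $\gamma$. A reparameterization of $\theta$ is any vector of the form $\theta^\lambda$. **Adding triplets.** Adding a triplet $\{r,u,v\}$ to $\mathcal{F}$ means adding this set and every two-element subset of it, unless already present (degenerate "triplets" $\{r,r,v\}$ are just pairs). New factors receive zero costs, and $J$ is the corresponding set for the enlarged $\mathcal{F}'$. **Signed partition graph and frustrated cycles.** For $v\in V$ and each $a\in\mathcal{X}_v$ with $\theta_v(a)\le\min_b\theta_v(b)+\varepsilon$, let $\Pi_v$ contain the partition $\pi=(\pi^+,\pi^-)=(\{a\},\mathcal{X}_v\setminus\{a\})$ of $\mathcal{X}_v$ into two non-empty sets. Let $\Pi$ be the disjoint union of the sets $\Pi_v$, $v\in V$. For $\pi_u\in\Pi_u$, $\pi_v\in\Pi_v$ with $\{u,v\}\in E$ put $$w(\pi_u,\pi_v)=\min_{\substack{(a,b)\in\mathcal{X}_u\times\mathcal{X}_v\\ [a\in\pi_u^+]\ne[b\in\pi_v^+]}}\theta_{uv}(a,b)\;-\;\min_{\substack{(a,b)\in\mathcal{X}_u\times\mathcal{X}_v\\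 [a\in\pi_u^+]=[b\in\pi_v^+]}}\theta_{uv}(a,b),$$ where $[\cdot]$ is the Iverson bracket; otherwise $w(\pi_u,\pi_v)=0$. $\mathcal{G}=(\Pi,\mathcal{E})$ is the undirected graph with edges $\{\pi_u,\pi_v\}$ such that $|w(\pi_u,\pi_v)|>\varepsilon$; an edge is positive if $w>\varepsilon$ and negative if $w<-\varepsilon$. A cycle of $\mathcal{G}$ is frustrated if it contains an odd number of negative edges. **CSP and AC.** $CSP_\varepsilon^{\le 2}(\theta)$ is the constraint satisfaction instance with nodes $V$, domains $\mathcal{X}_v$, factors $V\cup E$, and relations $\mathcal{Y}_\alpha=\{x_\alpha\in\mathcal{X}_\alpha:\theta_\alpha(x_\alpha)\le\min_{y_\alpha}\theta_\alpha(y_\alpha)+\varepsilon\}$. The AC (arc consistency) algorithm repeats while possible: (1) for $\{u,v\}\in E$, remove from $\mathcal{Y}_{uv}$ a pair $(a,b)$ with $a\notin\mathcal{Y}_u$; (2) for $\{u,v\}\in E$, remove from $\mathcal{Y}_u$ a label $a$ such that $(a,b)\notin\mathcal{Y}_{uv}$ for all $b\in\mathcal{X}_v$. Inconsistency means that some $\mathcal{Y}_v$ becomes empty, at which point the run stops. **Triplets of an AC run.** Suppose fixing $r$ to $s$ (replacing $\mathcal{Y}_r$ by $\{s\}$) and running AC causes inconsistency. For a minimal sequence of AC operations causing inconsistency, let $a_1,a_2,\ldots$ be the removed labels in order, $a_i\in\mathcal{X}_{v_i}$, and let $u_i$ be the node causing the deletion of $a_i$, i.e. $\{u_i,v_i\}\in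 E$ and at that moment no $b$ in the current $\mathcal{Y}_{u_i}$ satisfies $(b,a_i)\in\mathcal{Y}_{u_iv_i}$. If the sequence ends with emptying a node $v\ne r$, it is extended by $s$ with $v_K=r$, $u_K=v$; so always $a_K=s$, $v_K=r$. The associated set of triplets consists of $\{r,u_i,v_i\}$, $i=1,\ldots,K$ (including degenerate ones $\{r,r,v\}$). **Algorithm FindTriplets (SAC tightening).** 1. Let $\mathcal{I}=(V,\mathcal{X},V\cup E,\mathcal{Y})=CSP_\varepsilon^{\le 2}(\theta)$. 2. Update $\mathcal{I}$ by running AC. 3. For every $r\in V$, $s\in\mathcal{Y}_r$: fix $r$ to $s$ and run AC. If this causes inconsistency, find a minimal set of operations causing it and let $\mathcal{A}_{rs}$ be the associated set of triplets; otherwise $\mathcal{A}_{rs}=\varnothing$. Restore $\mathcal{I}$. 4. For $r\in V$ let $\mathcal{L}_r=\{s\in\mathcal{Y}_r:\mathcal{A}_{rs}\ne\varnothing\}$ and $\mathcal{A}_r=\bigcup_{s\in\mathcal{Y}_r}\mathcal{A}_{rs}$. Choose a total order $\preceq$ on $V$ such that (1) $r\prec r'$ if $\mathcal{L}_r=\mathcal{Y}_r$ and $\mathcal{L}_{r'}\ne\mathcal{Y}_{r'}$; (2) otherwise, $r\prec r'$ if $|\mathcal{A}_r|<|\mathcal{A}_{r'}|$ (degenerate triplets not being counted). 5. Set $\mathcal{A}\leftarrow\varnothing$; go through $r\in V$ in the order $\preceq$ and add $\mathcal{A}_r$ to $\mathcal{A}$ whenever $\mathcal{A}\cap\mathcal{A}_r=\varnothing$.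 6. Return $\mathcal{A}$. -}

module Defs where

open import Level using (_⊔_) renaming (suc to lsuc)
open import Algebra.Bundles using (CommutativeRing)
open import Algebra.Definitions using (Invertible)
open import Data.Bool.Base using (Bool; T; _∧_; not; if_then_else_)
import Data.Bool.Properties as Bool
open import Data.Fin.Base using (Fin; zero; suc)
import Data.Fin.Properties as Fin
open import Data.Fin.Subset using (Subset; inside; outside; ⁅_⁆; _∪_; ∁; ∣_∣; _∈_; _⊆_; _⊂_; Nonempty)
  renaming (⊥ to ∅)
open import Data.Fin.Subset.Properties
  using (_∈?_; _⊆?_; _⊂?_; x∈⁅x⁆; p⊆p∪q; q⊆p∪q; drop-∷-⊆)
open import Data.List.Base
  using (List; []; _∷_; [_]; _++_; _∷ʳ_; map; concatMap; cartesianProductWith; filter; foldr; length; zip; allFin; deduplicate)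
import Data.List.Extrema as Extrema
import Data.List.Membership.DecPropositional as DecMembership
open import Data.List.Membership.Propositional using () renaming (_∈_ to _∈ˢ_)
open import Data.List.Relation.Binary.Sublist.Propositional using () renaming (_⊆_ to _⊑_)
open import Data.List.Relation.Unary.All using (All; all?)
open import Data.List.Relation.Unary.Unique.Propositional using (Unique)
import Data.List.Sort as Sort
open import Data.Nat.Base as ℕ using (ℕ)
open import Data.Nat.DivMod using (_%_)
import Data.Nat.Properties as ℕ
open import Data.Product.Base using (Σ; Σ-syntax; ∃-syntax; _×_; _,_; proj₁; proj₂; uncurry)
import Data.Product.Properties as Product
open import Data.Sum.Base using (_⊎_)
open import Data.Vec.Base using ([]; _∷_; here; there)
import Data.Vec.Properties as Vec
open import Function.Base using (_∘_)
open import Relation.Binary.Bundles using (DecTotalOrder)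
import Relation.Binary.Construct.NonStrictToStrict as NonStrictToStrict
open import Relation.Binary.Core using (Rel)
open import Relation.Binary.Definitions using (Decidable; DecidableEquality)
open import Relation.Binary.PropositionalEquality.Core using (_≡_; _≢_; refl; cong)
open import Relation.Binary.Structures using (IsDecTotalOrder)
open import Relation.Nullary using (¬_; Dec; yes; no; does)
open import Relation.Nullary.Decidable using (map′; _×-dec_; ¬?; T?)
open import Relation.Unary using (Pred; _≐_)

-- The costs live in an arbitrary ordered field with decidable order. The
-- real numbers, with their classical order, are one.

record OrderedField c ℓ₁ ℓ₂ : Set (lsuc (c ⊔ ℓ₁ ⊔ ℓ₂)) where
  field
    commutativeRing : CommutativeRing c ℓ₁

  open CommutativeRing commutativeRing public

  infix 4 _≤_ _<?_

  field
    _≤_             : Rel Carrier ℓ₂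
    isDecTotalOrder : IsDecTotalOrder _≈_ _≤_
    0≉1             : ¬ 0# ≈ 1#
    invertible      : ∀ x → ¬ x ≈ 0# → Invertible _≈_ 1# _*_ x
    +-monoʳ-≤       : ∀ x {y z} → y ≤ z → x + y ≤ x + z
    *-nonNegative   : ∀ {x y} → 0# ≤ x → 0# ≤ y → 0# ≤ x * y

  decTotalOrder : DecTotalOrder c ℓ₁ ℓ₂
  decTotalOrder = record { isDecTotalOrder = isDecTotalOrder }

  open DecTotalOrder decTotalOrder public using (_≟_; _≤?_; totalOrder)
  open NonStrictToStrict _≈_ _≤_ public using (_<_)

  _<?_ : Decidable _<_
  _<?_ = NonStrictToStrict.<-decidable _≈_ _≤_ _≟_ _≤?_

  ∣_∣ₖ : Carrier → Carrier
  ∣ x ∣ₖ = Extrema.max totalOrder x [ - x ]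

  -- The value on the empty list is a convention that is never used: all
  -- label sets are non-empty, and so are both parts of a partition in Π.
  minimum : List Carrier → Carrier
  minimum []       = 0#
  minimum (x ∷ xs) = Extrema.min totalOrder x xs

-- Finite sets of nodes; a finite set of subsets of V = Fin n is given by
-- a list, of which only the membership relation matters.

subsets : ∀ n → List (Subset n)
subsets ℕ.zero    = [ [] ]
subsets (ℕ.suc n) = map (outside ∷_) (subsets n) ++ map (inside ∷_) (subsets n)

_≟ˢ_ : ∀ {n} → DecidableEquality (Subset n)
_≟ˢ_ = Vec.≡-dec Bool._≟_

module _ {n : ℕ} where

  open DecMembership (_≟ˢ_ {n}) public using () renaming (_∈?_ to _∈ˢ?_)

  pair : Fin n → Fin n → Subset n
  pair u v = ⁅ u ⁆ ∪ ⁅ v ⁆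

  triplet : Fin n → Fin n → Fin n → Subset n
  triplet r u v = ⁅ r ⁆ ∪ pair u v

  first∈pair : ∀ u v → u ∈ pair u v
  first∈pair u v = p⊆p∪q ⁅ v ⁆ (x∈⁅x⁆ u)

  second∈pair : ∀ u v → v ∈ pair u v
  second∈pair u v = q⊆p∪q ⁅ u ⁆ ⁅ v ⁆ (x∈⁅x⁆ v)

  record IsFactorSet (F : List (Subset n)) : Set where
    field
      nonempty   : ∀ {α} → α ∈ˢ F → Nonempty α
      size≤3     : ∀ {α} → α ∈ˢ F → ∣ α ∣ ℕ.≤ 3
      singletons : ∀ v → ⁅ v ⁆ ∈ˢ F
      pairs      : ∀ {α β} → α ∈ˢ F → ∣ α ∣ ≡ 3 → β ⊆ α → ∣ β ∣ ≡ 2 → β ∈ˢ F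

  Edge : List (Subset n) → Subset n → Set
  Edge F α = α ∈ˢ F × ∣ α ∣ ≡ 2

  edge? : ∀ F α → Dec (Edge F α)
  edge? F α = (α ∈ˢ? F) ×-dec (∣ α ∣ ℕ.≟ 2)

  J : List (Subset n) → Subset n → Subset n → Set
  J F α β = α ∈ˢ F × β ∈ˢ F × β ⊂ α × ∣ α ∣ ≡ ∣ β ∣ ℕ.+ 1

  J? : ∀ F α β → Dec (J F α β)
  J? F α β = (α ∈ˢ? F) ×-dec (β ∈ˢ? F) ×-dec (β ⊂? α) ×-dec (∣ α ∣ ℕ.≟ ∣ β ∣ ℕ.+ 1)

  J⇒⊆ : ∀ {F α β} → J F α β → β ⊆ α
  J⇒⊆ (_ , _ , β⊂α , _) = proj₁ β⊂α

  -- A degenerate triplet {r,r,v} is the two-element set {r,v}; its only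
  -- two-element subset is itself.
  addTriplets : List (Subset n) → List (Subset n) → List (Subset n)
  addTriplets F A = F ++ concatMap closure A
    where
    closure : Subset n → List (Subset n)
    closure τ = τ ∷ filter (λ β → (β ⊆? τ) ×-dec (∣ β ∣ ℕ.≟ 2)) (subsets n)

-- The label set of v is Fin (suc (k v)), an arbitrary finite non-empty
-- set, and Labelling k α is the product of the label sets of the nodes
-- in α. It is a first-order product, rather than a type of dependent
-- functions, so that its equality is decidable without extensionality.

Label : ∀ {n} → (Fin n → ℕ) → Fin n → Set
Label k v = Fin (ℕ.suc (k v))

data Labelling : ∀ {n} → (Fin n → ℕ) → Subset n → Set where
  []   : ∀ {k} → Labelling k []
  _∷_  : ∀ {n k} {α : Subset n} →
         Label k zero → Labelling (k ∘ suc) α → Labelling k (inside ∷ α)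
  skip : ∀ {n k} {α : Subset n} →
         Labelling (k ∘ suc) α → Labelling k (outside ∷ α)

lookup : ∀ {n k} {α : Subset n} {v} → Labelling k α → v ∈ α → Label k v
lookup (a ∷ x)  here      = a
lookup (a ∷ x)  (there p) = lookup x p
lookup (skip x) (there p) = lookup x p

restrict : ∀ {n k} {α β : Subset n} → β ⊆ α → Labelling k α → Labelling k β
restrict {β = []}          β⊆α []       = []
restrict {β = inside ∷ β}  β⊆α (a ∷ x)  = a ∷ restrict (drop-∷-⊆ β⊆α) x
restrict {β = outside ∷ β} β⊆α (a ∷ x)  = skip (restrict (drop-∷-⊆ β⊆α) x)
restrict {β = outside ∷ β} β⊆α (skip x) = skip (restrict (drop-∷-⊆ β⊆α) x)
restrict {β = inside ∷ β}  β⊆α (skip x) with () ← β⊆α here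

empty : ∀ {n k} → Labelling {n} k ∅
empty {ℕ.zero}  = []
empty {ℕ.suc n} = skip empty

single : ∀ {n k} (v : Fin n) → Label k v → Labelling k ⁅ v ⁆
single zero    a = a ∷ empty
single (suc v) a = skip (single v a)

labellings : ∀ {n} k (α : Subset n) → List (Labelling k α)
labellings k []            = [ [] ]
labellings k (inside ∷ α)  = cartesianProductWith _∷_ (allFin _) (labellings (k ∘ suc) α)
labellings k (outside ∷ α) = map skip (labellings (k ∘ suc) α)

_≟ˡ_ : ∀ {n k} {α : Subset n} → DecidableEquality (Labelling k α)
[]       ≟ˡ []       = yes refl
(a ∷ x)  ≟ˡ (b ∷ y)  = map′ (λ { (refl , refl) → refl }) (λ { refl → refl , refl })
                            ((a Fin.≟ b) ×-dec (x ≟ˡ y))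
(skip x) ≟ˡ (skip y) = map′ (cong skip) (λ { refl → refl }) (x ≟ˡ y)

module _ {c ℓ₁ ℓ₂} (K : OrderedField c ℓ₁ ℓ₂) {n : ℕ} (k : Fin n → ℕ) where

  open OrderedField K

  -- For a set of factors F, only the components θ α with α in F are
  -- meaningful; all definitions below ignore the others.
  Cost : Set c
  Cost = ∀ α → Labelling k α → Carrier

  -- A sum over the subsets of V satisfying a condition P is written as
  -- Σ-subsets of the summands [ P? ⇒ f ].
  Σ-subsets : (Subset n → Carrier) → Carrier
  Σ-subsets f = foldr _+_ 0# (map f (subsets n))

  [_⇒_] : ∀ {p} {P : Set p} → Dec P → (P → Carrier) → Carrier
  [ yes p ⇒ f ] = f p
  [ no  _ ⇒ f ] = 0#

  minOver : ∀ {α} → (Labelling k α → Carrier) → Carrier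
  minOver {α} f = minimum (map f (labellings k α))

  Φ : List (Subset n) → Cost → Carrier
  Φ F θ = Σ-subsets λ α → [ α ∈ˢ? F ⇒ (λ _ → minOver (θ α)) ]

  -- lam α β is λ_{αβ}; only its values for (α , β) in J matter.
  reparameterize : List (Subset n) → Cost →
                   (∀ (α β : Subset n) → Labelling k β → Carrier) → Cost
  reparameterize F θ lam β x =
      θ β x
    + Σ-subsets (λ α → [ J? F α β ⇒ (λ _ → lam α β x) ])
    - Σ-subsets (λ γ → [ J? F β γ ⇒ (λ j → lam β γ (restrict (J⇒⊆ {F = F} j) x)) ])

  IsReparameterization : List (Subset n) → Cost → Cost → Set (c ⊔ ℓ₁)
  IsReparameterization F θ θ′ =
    ∃[ lam ] ∀ {α} → α ∈ˢ F → ∀ x → θ′ α x ≈ reparameterize F θ lam α x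

  extendByZero : List (Subset n) → Cost → Cost
  extendByZero F θ α x = [ α ∈ˢ? F ⇒ (λ _ → θ α x) ]

  module PartitionGraph (F : List (Subset n)) (θ : Cost) (ε : Carrier) where

    -- The partition (π⁺ , π⁻) of the label set of v is given by v and π⁺,
    -- with π⁻ = ∁ π⁺.
    Partition : Set
    Partition = Σ[ v ∈ Fin n ] Subset (ℕ.suc (k v))

    record _∈Π (π : Partition) : Set ℓ₂ where
      field
        a           : Label k (proj₁ π)
        π⁺≡⁅a⁆      : proj₂ π ≡ ⁅ a ⁆
        π⁻-nonempty : Nonempty (∁ (proj₂ π))
        near-min    : θ ⁅ proj₁ π ⁆ (single (proj₁ π) a) ≤ minOver (θ ⁅ proj₁ π ⁆) + ε

    w : Partition → Partition → Carrier
    w (u , π⁺ᵤ) (v , π⁺ᵥ) =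
      [ edge? F (pair u v) ⇒ (λ _ →
          minimum (map (θ (pair u v)) (filter (¬? ∘ sameSide?) (labellings k (pair u v))))
        - minimum (map (θ (pair u v)) (filter sameSide? (labellings k (pair u v))))) ]
      where
      sameSide? : ∀ x → Dec (does (lookup x (first∈pair u v) ∈? π⁺ᵤ)
                             ≡ does (lookup x (second∈pair u v) ∈? π⁺ᵥ))
      sameSide? x = _ Bool.≟ _

    Adjacent : Partition × Partition → Set (ℓ₁ ⊔ ℓ₂)
    Adjacent (π , ρ) = ε < ∣ w π ρ ∣ₖ

    negative? : ∀ (e : Partition × Partition) → Dec (uncurry w e < - ε)
    negative? (π , ρ) = w π ρ <? - ε

    cyclicPairs : List Partition → List (Partition × Partition)
    cyclicPairs []       = []
    cyclicPairs (π ∷ πs) = zip (π ∷ πs) (πs ∷ʳ π)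

    record FrustratedCycle : Set (ℓ₁ ⊔ ℓ₂) where
      field
        vertices : List Partition
        inΠ      : All _∈Π vertices
        distinct : Unique vertices
        length≥3 : 3 ℕ.≤ length vertices
        edges    : All Adjacent (cyclicPairs vertices)
        odd      : length (filter negative? (cyclicPairs vertices)) % 2 ≡ 1

module ArcConsistency {n : ℕ} (k : Fin n → ℕ) (F : List (Subset n)) where

  -- The relations of an instance with factors V ∪ E. Only the values at
  -- singletons and edges matter.
  CSP : Set
  CSP = ∀ α → Labelling k α → Bool

  Dom : CSP → ∀ v → Pred (Label k v) _
  Dom I v a = T (I ⁅ v ⁆ (single v a))

  Rel₂ : CSP → ∀ u v → Pred (Labelling k (pair u v)) _
  Rel₂ I u v x = T (I (pair u v) x)

  dom : CSP → ∀ v → List (Label k v)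
  dom I v = filter (λ a → T? (I ⁅ v ⁆ (single v a))) (allFin _)

  _≟ᴵ_ : DecidableEquality (Σ (Subset n) (Labelling k))
  _≟ᴵ_ = Product.≡-dec _≟ˢ_ _≟ˡ_

  remove : Σ (Subset n) (Labelling k) → CSP → CSP
  remove item I α x = I α x ∧ not (does ((α , x) ≟ᴵ item))

  fix : ∀ r → Label k r → CSP → CSP
  fix r s I α x = if does (α ≟ˢ ⁅ r ⁆)
                  then does ((α , x) ≟ᴵ (⁅ r ⁆ , single r s))
                  else I α x

  -- removePair u v x removes the pair x of {u,v} because its label at u
  -- is gone; removeLabel u v a removes the label a of v because it has no
  -- support in {u,v}, so that u is the node causing the deletion.
  data Operation : Set where
    removePair  : ∀ (u v : Fin n) → Labelling k (pair u v) → Operation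
    removeLabel : ∀ (u v : Fin n) → Label k v → Operation

  data Enabled (I : CSP) : Operation → Set where
    removePair  : ∀ {u v x} → Edge F (pair u v) → Rel₂ I u v x →
                  ¬ Dom I u (lookup x (first∈pair u v)) →
                  Enabled I (removePair u v x)
    removeLabel : ∀ {u v a} → Edge F (pair u v) → Dom I v a →
                  (∀ x → lookup x (second∈pair u v) ≡ a → ¬ Rel₂ I u v x) →
                  Enabled I (removeLabel u v a)

  apply : Operation → CSP → CSP
  apply (removePair u v x)  = remove (pair u v , x)
  apply (removeLabel u v a) = remove (⁅ v ⁆ , single v a)

  EmptyAt : CSP → Fin n → Set
  EmptyAt I v = ∀ a → ¬ Dom I v a

  Inconsistent : CSP → Set
  Inconsistent I = ∃[ v ] EmptyAt I v

  infixr 5 _∷_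

  data Run : CSP → List Operation → CSP → Set where
    []  : ∀ {I} → Run I [] I
    _∷_ : ∀ {I o os I′} → ¬ Inconsistent I × Enabled I o →
          Run (apply o I) os I′ → Run I (o ∷ os) I′

  CompleteRun : CSP → List Operation → CSP → Set
  CompleteRun I os I′ = Run I os I′ × (Inconsistent I′ ⊎ (∀ o → ¬ Enabled I′ o))

  CausesInconsistency : CSP → List Operation → Set
  CausesInconsistency I os = ∃[ I′ ] Run I os I′ × Inconsistent I′

  -- This holds in particular for sequences of minimum length, and for
  -- sequences whose set of operations is minimal under inclusion.
  Minimal : CSP → List Operation → Set
  Minimal I os = ∀ os′ → os′ ⊑ os → CausesInconsistency I os′ → os′ ≡ os

  deletionTriplets : Fin n → List Operation → List (Subset n)
  deletionTriplets r []                       = []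
  deletionTriplets r (removePair u v x ∷ os)  = deletionTriplets r os
  deletionTriplets r (removeLabel u v a ∷ os) = triplet r u v ∷ deletionTriplets r os

  -- The second argument is the node whose label set has been emptied.
  associatedTriplets : Fin n → Fin n → List Operation → List (Subset n)
  associatedTriplets r v os =
    if does (v Fin.≟ r) then deletionTriplets r os
                        else deletionTriplets r os ∷ʳ triplet r v r

  -- Search I r s A: fixing r to s in I and running AC may yield A.
  data Search (I : CSP) (r : Fin n) (s : Label k r) : List (Subset n) → Set where
    consistent   : ∀ {os I′} → CompleteRun (fix r s I) os I′ → ¬ Inconsistent I′ →
                   Search I r s []
    inconsistent : ∀ {os I′ v} → Run (fix r s I) os I′ → EmptyAt I′ v →
                   Minimal (fix r s I) os →
                   Search I r s (associatedTriplets r v os)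

-- The algorithm is nondeterministic; FindTriplets is the type of its
-- executions, each given by the choices it makes.

module _ {c ℓ₁ ℓ₂} (K : OrderedField c ℓ₁ ℓ₂) {n : ℕ} (k : Fin n → ℕ)
         (F : List (Subset n)) (θ : Cost K k) (ε : OrderedField.Carrier K) where

  open OrderedField K
  open ArcConsistency k F

  initialCSP : CSP
  initialCSP α x = does (θ α x ≤? minOver K k (θ α) + ε)

  record FindTriplets : Set₁ where
    field
      operations : List Operation
      I          : CSP
      runAC      : CompleteRun initialCSP operations I

      -- 𝓐 r s is only used for s in the domain of r.
      𝓐          : ∀ r → Label k r → List (Subset n)
      search     : ∀ r s → Dom I r s → Search I r s (𝓐 r s)

    𝓨 : ∀ r → Pred (Label k r) _
    𝓨 = Dom I

    𝓛 : ∀ r → Pred (Label k r) _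
    𝓛 r s = 𝓨 r s × 𝓐 r s ≢ []

    𝓐ᵣ : Fin n → List (Subset n)
    𝓐ᵣ r = concatMap (𝓐 r) (dom I r)

    Full : Fin n → Set
    Full r = 𝓛 r ≐ 𝓨 r

    size : Fin n → ℕ
    size r = length (deduplicate _≟ˢ_ (filter (λ τ → ∣ τ ∣ ℕ.≟ 3) (𝓐ᵣ r)))

    Rule₁ : Rel (Fin n) _
    Rule₁ r r′ = Full r × ¬ Full r′

    Rule₂ : Rel (Fin n) _
    Rule₂ r r′ = ¬ Rule₁ r r′ × ¬ Rule₁ r′ r × size r ℕ.< size r′

    field
      _≼_               : Rel (Fin n) _
      ≼-isDecTotalOrder : IsDecTotalOrder _≡_ _≼_
      respects          : ∀ {r r′} → Rule₁ r r′ ⊎ Rule₂ r r′ → r ≼ r′ × r ≢ r′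

    ≼-decTotalOrder : DecTotalOrder _ _ _
    ≼-decTotalOrder = record { isDecTotalOrder = ≼-isDecTotalOrder }

    open Sort ≼-decTotalOrder using (sort)

    collect : List (Subset n) → List (Fin n) → List (Subset n)
    collect A []       = A
    collect A (r ∷ rs) with all? (λ τ → ¬? (τ ∈ˢ? A)) (𝓐ᵣ r)
    ... | yes _ = collect (A ++ 𝓐ᵣ r) rs
    ... | no  _ = collect A rs

    output : List (Subset n)
    output = collect [] (sort (allFin n))

{-# OPTIONS --safe #-}
module Submission where

-- Follow the cycle from a vertex in the node r: as soon as the domain of r
-- is a single label, arc consistency makes every domain along the cycle lie
-- on one side of its partition, and the odd number of negative edges brings
-- back the opposite side at r. So every label of r is refuted, and the first
-- node in the order ≼ is one all of whose labels are refuted.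
--
-- Call an assignment to a factor strict if its current cost exceeds the
-- original minimum of that factor. Starting from θ, costs are moved by small
-- amounts along pairs in J so that no cost falls below the original minimum
-- and strictness is never lost. With r = s fixed, a removed element of α
-- corresponds to a factor inside {r} ∪ α that is strict at it. When label a
-- of v is removed because of u, every assignment to {r,u,v} with x_r = s and
-- x_v = a has such a factor inside; moving all excess up to {r,u,v} and then
-- down to {r,v} makes {r,v} strict at (s,a). The inconsistency finally makes
-- s strict at r; doing so for every s raises the minimum at r.

open import Defs
open import Level using (_⊔_)
import Algebra.Properties.AbelianGroup as AbelianGroupProperties
import Algebra.Properties.CommutativeSemigroup as CommutativeSemigroupProperties
import Algebra.Properties.Ring as RingProperties
open import Data.Bool.Base using (Bool; true; false; T; _∧_; not; if_then_else_)
import Data.Bool.Properties as Bool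
open import Data.Empty using (⊥)
open import Data.Fin.Base using (Fin; zero; suc)
import Data.Fin.Properties as Fin
open import Data.Fin.Subset
  using (Subset; inside; outside; ⁅_⁆; _∪_; _∈_; _∉_; _⊆_; ∣_∣; Nonempty)
  renaming (⊥ to ∅)
open import Data.Fin.Subset.Properties
open import Data.List.Base
  using (List; []; _∷_; _++_; _∷ʳ_; map; foldr; filter; allFin; length; zip)
import Data.List.Extrema as Extrema
open import Data.List.Membership.Propositional using () renaming (_∈_ to _∈ˢ_)
open import Data.List.Membership.Propositional.Properties
import Data.List.Properties as List
open import Data.List.Relation.Binary.Permutation.Propositional using (↭-sym)
open import Data.List.Relation.Binary.Permutation.Propositional.Properties using (∈-resp-↭)
open import Data.List.Relation.Unary.All as All using (All; []; _∷_; all?)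
import Data.List.Relation.Unary.All.Properties as All
open import Data.List.Relation.Unary.AllPairs using ([]; _∷_)
open import Data.List.Relation.Unary.Any as Any using (here; there)
import Data.List.Relation.Unary.Linked.Properties as Linked
import Data.List.Relation.Unary.Sorted.TotalOrder as Sorted
open import Data.List.Relation.Unary.Unique.Propositional using (Unique)
import Data.List.Relation.Unary.Unique.Propositional.Properties as Unique
import Data.List.Sort as Sort
open import Data.Nat.Base as ℕ using (ℕ)
open import Data.Nat.DivMod using (_%_)
import Data.Nat.Properties as ℕ
open import Data.Product.Base using (Σ; ∃-syntax; _×_; _,_; proj₁; proj₂)
import Data.Product.Properties as Product
open import Data.Sum.Base using (_⊎_; inj₁; inj₂; [_,_]; [_,_]′)
open import Data.Unit.Base using (⊤; tt)
open import Data.Vec.Base using ([]; _∷_; here; there)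
import Data.Vec.Properties as Vec
open import Function.Base using (_∘_; id)
open import Relation.Binary.Bundles using (DecTotalOrder)
import Relation.Binary.Construct.NonStrictToStrict as NonStrictToStrict
open import Relation.Binary.PropositionalEquality as ≡ using (_≡_; _≢_)
import Relation.Binary.Reasoning.PartialOrder as PartialOrderReasoning
open import Relation.Nullary
open import Relation.Nullary.Decidable
  using (_×-dec_; _→-dec_; ¬?; T?; dec-true; dec-false; decidable-stable)
open import Relation.Unary using (_≐_)

-- Subsets and labellings

∣⁅i⁆∪p∣≡∣p∣+1 : ∀ {n} {i : Fin n} {p} → i ∉ p → ∣ ⁅ i ⁆ ∪ p ∣ ≡ ∣ p ∣ ℕ.+ 1
∣⁅i⁆∪p∣≡∣p∣+1 {i = zero}  {inside  ∷ p} i∉p = contradiction here i∉p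
∣⁅i⁆∪p∣≡∣p∣+1 {i = zero}  {outside ∷ p} i∉p =
  ≡.trans (≡.cong (ℕ.suc ∘ ∣_∣) (∪-identityˡ p)) (ℕ.+-comm 1 ∣ p ∣)
∣⁅i⁆∪p∣≡∣p∣+1 {i = suc i} {inside  ∷ p} i∉p = ≡.cong ℕ.suc (∣⁅i⁆∪p∣≡∣p∣+1 (i∉p ∘ there))
∣⁅i⁆∪p∣≡∣p∣+1 {i = suc i} {outside ∷ p} i∉p = ∣⁅i⁆∪p∣≡∣p∣+1 (i∉p ∘ there)

module _ {n : ℕ} where

  ∪-least : ∀ {p q r : Subset n} → p ⊆ r → q ⊆ r → p ∪ q ⊆ r
  ∪-least {p} {q} p⊆r q⊆r i∈p∪q = [ p⊆r , q⊆r ] (x∈p∪q⁻ p q i∈p∪q)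

  ⁅⁆-⊆ : ∀ {i} {p : Subset n} → i ∈ p → ⁅ i ⁆ ⊆ p
  ⁅⁆-⊆ {i} i∈p j∈⁅i⁆ = ≡.subst (_∈ _) (≡.sym (x∈⁅y⁆⇒x≡y i j∈⁅i⁆)) i∈p

-- Total assignments and their restrictions

Assignment : ∀ {n} → (Fin n → ℕ) → Set
Assignment k = ∀ v → Label k v

Agree : ∀ {n} {k : Fin n → ℕ} → Subset n → Assignment k → Assignment k → Set
Agree α f g = ∀ {i} → i ∈ α → f i ≡ g i

-- Restrictions of one total assignment to different factors are compatible by construction, so
-- passing to a smaller factor needs no inclusion proof.
tab : ∀ {n} {k : Fin n → ℕ} → Assignment k → ∀ α → Labelling k α
tab f []            = []
tab f (inside  ∷ α) = f zero ∷ tab (f ∘ suc) α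
tab f (outside ∷ α) = skip (tab (f ∘ suc) α)

infixl 6 _◁_ _[_≔_]

-- Overwriting realizes every labelling as a restriction (`tab-◁`), which carries results stated for
-- `tab f α` over to arbitrary labellings.
_◁_ : ∀ {n} {k : Fin n → ℕ} {α} → Assignment k → Labelling k α → Assignment k
(f ◁ (a ∷ x)) zero    = a
(f ◁ skip x)  zero    = f zero
(f ◁ (a ∷ x)) (suc v) = ((f ∘ suc) ◁ x) v
(f ◁ skip x)  (suc v) = ((f ∘ suc) ◁ x) v

_[_≔_] : ∀ {n} {k : Fin n → ℕ} → Assignment k → ∀ v → Label k v → Assignment k
f [ v ≔ a ] = f ◁ single v a

tab-cong : ∀ {n} {k : Fin n → ℕ} {f g : Assignment k} {α} → Agree α f g → tab f α ≡ tab g α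
tab-cong {α = []}          f≗g = ≡.refl
tab-cong {α = inside  ∷ α} f≗g = ≡.cong₂ _∷_ (f≗g here) (tab-cong (f≗g ∘ there))
tab-cong {α = outside ∷ α} f≗g = ≡.cong skip (tab-cong (f≗g ∘ there))

lookup-tab : ∀ {n} {k : Fin n → ℕ} (f : Assignment k) {α v} (p : v ∈ α) → lookup (tab f α) p ≡ f v
lookup-tab f {inside  ∷ α} here      = ≡.refl
lookup-tab f {inside  ∷ α} (there p) = lookup-tab (f ∘ suc) p
lookup-tab f {outside ∷ α} (there p) = lookup-tab (f ∘ suc) p

tab-injective : ∀ {n} {k : Fin n → ℕ} {f g : Assignment k} {α} → tab f α ≡ tab g α → Agree α f g
tab-injective {f = f} {g} eq p =
  ≡.trans (≡.sym (lookup-tab f p)) (≡.trans (≡.cong (λ x → lookup x p) eq) (lookup-tab g p))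

tab-item : ∀ {n} {k : Fin n → ℕ} {f : Assignment k} {α β} {y : Labelling k β} →
           _≡_ {A = Σ (Subset n) (Labelling k)} (α , tab f α) (β , y) → α ≡ β × tab f β ≡ y
tab-item ≡.refl = ≡.refl , ≡.refl

tab-◁ : ∀ {n} {k : Fin n → ℕ} (f : Assignment k) {α} (x : Labelling k α) → tab (f ◁ x) α ≡ x
tab-◁ f []       = ≡.refl
tab-◁ f (a ∷ x)  = ≡.cong (a ∷_) (tab-◁ (f ∘ suc) x)
tab-◁ f (skip x) = ≡.cong skip (tab-◁ (f ∘ suc) x)

◁-lookup : ∀ {n} {k : Fin n → ℕ} (f : Assignment k) {α} (x : Labelling k α) {v} (p : v ∈ α) →
           (f ◁ x) v ≡ lookup x p
◁-lookup f (a ∷ x)  here      = ≡.refl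
◁-lookup f (a ∷ x)  (there p) = ◁-lookup (f ∘ suc) x p
◁-lookup f (skip x) (there p) = ◁-lookup (f ∘ suc) x p

◁-outside : ∀ {n} {k : Fin n → ℕ} (f : Assignment k) {α} (x : Labelling k α) {v} → v ∉ α →
            (f ◁ x) v ≡ f v
◁-outside f (a ∷ x)  {zero}  p = contradiction here p
◁-outside f (skip x) {zero}  p = ≡.refl
◁-outside f (a ∷ x)  {suc v} p = ◁-outside (f ∘ suc) x (p ∘ there)
◁-outside f (skip x) {suc v} p = ◁-outside (f ∘ suc) x (p ∘ there)

restrict-tab : ∀ {n} {k : Fin n → ℕ} (f : Assignment k) {α β} (β⊆α : β ⊆ α) →
               restrict β⊆α (tab f α) ≡ tab f β
restrict-tab f {[]}          {[]}          β⊆α = ≡.refl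
restrict-tab f {inside  ∷ α} {inside  ∷ β} β⊆α = ≡.cong (f zero ∷_) (restrict-tab (f ∘ suc) (drop-∷-⊆ β⊆α))
restrict-tab f {inside  ∷ α} {outside ∷ β} β⊆α = ≡.cong skip (restrict-tab (f ∘ suc) (drop-∷-⊆ β⊆α))
restrict-tab f {outside ∷ α} {outside ∷ β} β⊆α = ≡.cong skip (restrict-tab (f ∘ suc) (drop-∷-⊆ β⊆α))
restrict-tab f {outside ∷ α} {inside  ∷ β} β⊆α with () ← β⊆α here

tab-restrict : ∀ {n} {k : Fin n → ℕ} (f : Assignment k) {α β} (x : Labelling k α) (β⊆α : β ⊆ α) →
               tab (f ◁ x) β ≡ restrict β⊆α x
tab-restrict f x β⊆α = ≡.trans (≡.sym (restrict-tab (f ◁ x) β⊆α)) (≡.cong (restrict β⊆α) (tab-◁ f x))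

tab-∅ : ∀ {n} {k : Fin n → ℕ} (f : Assignment k) → tab f ∅ ≡ empty
tab-∅ {ℕ.zero}  f = ≡.refl
tab-∅ {ℕ.suc n} f = ≡.cong skip (tab-∅ (f ∘ suc))

tab-⁅⁆ : ∀ {n} {k : Fin n → ℕ} (f : Assignment k) v → tab f ⁅ v ⁆ ≡ single v (f v)
tab-⁅⁆ f zero    = ≡.cong (f zero ∷_) (tab-∅ (f ∘ suc))
tab-⁅⁆ f (suc v) = ≡.cong skip (tab-⁅⁆ (f ∘ suc) v)

lookup-single : ∀ {n} {k : Fin n → ℕ} v (a : Label k v) (p : v ∈ ⁅ v ⁆) → lookup (single {k = k} v a) p ≡ a
lookup-single zero    a here      = ≡.refl
lookup-single {k = k} (suc v) a (there p) = lookup-single {k = k ∘ suc} v a p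

tab-⁅⁆⁻ : ∀ {n} {k : Fin n → ℕ} (f : Assignment k) {v a} → tab f ⁅ v ⁆ ≡ single v a → f v ≡ a
tab-⁅⁆⁻ {k = k} f {v} {a} eq = ≡.trans (≡.sym (lookup-tab f (x∈⁅x⁆ v)))
  (≡.trans (≡.cong (λ x → lookup x (x∈⁅x⁆ v)) eq) (lookup-single {k = k} v a (x∈⁅x⁆ v)))

single-injective : ∀ {n} {k : Fin n → ℕ} {v} {a b : Label k v} → single {k = k} v a ≡ single v b → a ≡ b
single-injective {k = k} {v} {a} {b} eq =
  ≡.trans (≡.sym (lookup-single {k = k} v a (x∈⁅x⁆ v)))
        (≡.trans (≡.cong (λ x → lookup x (x∈⁅x⁆ v)) eq) (lookup-single {k = k} v b (x∈⁅x⁆ v)))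

≔-updates : ∀ {n} {k : Fin n → ℕ} (f : Assignment k) v (a : Label k v) → (f [ v ≔ a ]) v ≡ a
≔-updates {k = k} f v a = ≡.trans (◁-lookup f (single v a) (x∈⁅x⁆ v)) (lookup-single {k = k} v a (x∈⁅x⁆ v))

≔-minimal : ∀ {n} {k : Fin n → ℕ} (f : Assignment k) {v i} (a : Label k v) → i ≢ v → (f [ v ≔ a ]) i ≡ f i
≔-minimal f {v} a i≢v = ◁-outside f (single v a) (x≢y⇒x∉⁅y⁆ i≢v)

∈-labellings : ∀ {n k} {α : Subset n} (x : Labelling k α) → x ∈ˢ labellings k α
∈-labellings []       = here ≡.refl
∈-labellings (a ∷ x)  = ∈-cartesianProductWith⁺ _∷_ (∈-allFin a) (∈-labellings x)
∈-labellings (skip x) = ∈-map⁺ skip (∈-labellings x)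

zeros : ∀ {n} {k : Fin n → ℕ} → Assignment k
zeros v = zero

∈-subsets : ∀ {n} (α : Subset n) → α ∈ˢ subsets n
∈-subsets []            = here ≡.refl
∈-subsets (outside ∷ α) = ∈-++⁺ˡ (∈-map⁺ (outside ∷_) (∈-subsets α))
∈-subsets (inside  ∷ α) = ∈-++⁺ʳ _ (∈-map⁺ (inside ∷_) (∈-subsets α))

subsets-unique : ∀ n → Unique (subsets n)
subsets-unique ℕ.zero    = [] ∷ []
subsets-unique (ℕ.suc n) =
  Unique.++⁺ (Unique.map⁺ Vec.∷-injectiveʳ (subsets-unique n))
             (Unique.map⁺ Vec.∷-injectiveʳ (subsets-unique n))
             disjoint
  where
  disjoint : ∀ {α} → α ∈ˢ map (outside ∷_) (subsets n) × α ∈ˢ map (inside ∷_) (subsets n) → ⊥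
  disjoint (p , q) with ∈-map⁻ _ p | ∈-map⁻ _ q
  ... | _ , _ , ≡.refl | _ , _ , ()

-- Ordered fields

module OrderedFieldProperties {c ℓ₁ ℓ₂} (K : OrderedField c ℓ₁ ℓ₂) where

  open OrderedField K
  open AbelianGroupProperties +-abelianGroup using (⁻¹-involutive; xyx⁻¹≈y)
  open RingProperties ring using (-‿distribˡ-*)
  open CommutativeSemigroupProperties +-commutativeSemigroup using (interchange)
  open DecTotalOrder decTotalOrder public
    using (poset; total; antisym; ≤-respˡ-≈; ≤-respʳ-≈)
    renaming (refl to ≤-refl; reflexive to ≤-reflexive; trans to ≤-trans)
  open NonStrictToStrict _≈_ _≤_ public using (<⇒≤)
  module ≤-Reasoning = PartialOrderReasoning poset

  <-≤-trans : ∀ {x y z} → x < y → y ≤ z → x < z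
  <-≤-trans = NonStrictToStrict.<-≤-trans _≈_ _≤_ sym ≤-trans antisym ≤-respʳ-≈

  ≤-<-trans : ∀ {x y z} → x ≤ y → y < z → x < z
  ≤-<-trans = NonStrictToStrict.≤-<-trans _≈_ _≤_ ≤-trans antisym ≤-respˡ-≈

  <⇒≱ : ∀ {x y} → x < y → ¬ y ≤ x
  <⇒≱ = NonStrictToStrict.<⇒≱ _≈_ _≤_ antisym

  ≰⇒> : ∀ {x y} → ¬ x ≤ y → y < x
  ≰⇒> = NonStrictToStrict.≰⇒> _≈_ _≤_ sym ≤-reflexive total

  ≮⇒≥ : ∀ {x y} → ¬ x < y → y ≤ x
  ≮⇒≥ = NonStrictToStrict.≮⇒≥ _≈_ _≤_ sym _≟_ ≤-reflexive total

  x+y-y≈x : ∀ x y → x + y - y ≈ x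
  x+y-y≈x x y = trans (+-assoc x y (- y)) (trans (+-congˡ (-‿inverseʳ y)) (+-identityʳ x))

  +-monoˡ-≤ : ∀ x {y z} → y ≤ z → y + x ≤ z + x
  +-monoˡ-≤ x {y} {z} y≤z = begin
    y + x ≈⟨ +-comm y x ⟩
    x + y ≤⟨ +-monoʳ-≤ x y≤z ⟩
    x + z ≈⟨ +-comm x z ⟩
    z + x ∎
    where open ≤-Reasoning

  +-monoʳ-< : ∀ x {y z} → y < z → x + y < x + z
  +-monoʳ-< x {y} {z} (y≤z , y≉z) =
    +-monoʳ-≤ x y≤z , λ eq → y≉z (trans (sym (xyx⁻¹≈y x y)) (trans (+-congʳ eq) (xyx⁻¹≈y x z)))

  +-monoˡ-< : ∀ x {y z} → y < z → y + x < z + x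
  +-monoˡ-< x {y} {z} y<z = begin-strict
    y + x ≈⟨ +-comm y x ⟩
    x + y <⟨ +-monoʳ-< x y<z ⟩
    x + z ≈⟨ +-comm x z ⟩
    z + x ∎
    where open ≤-Reasoning

  +-mono-≤ : ∀ {x y z w} → x ≤ y → z ≤ w → x + z ≤ y + w
  +-mono-≤ x≤y z≤w = ≤-trans (+-monoˡ-≤ _ x≤y) (+-monoʳ-≤ _ z≤w)

  -‿anti-≤ : ∀ {x y} → x ≤ y → - y ≤ - x
  -‿anti-≤ {x} {y} x≤y = begin
    - y           ≈⟨ xyx⁻¹≈y x (- y) ⟨
    x + - y - x   ≤⟨ +-monoˡ-≤ (- x) (+-monoˡ-≤ (- y) x≤y) ⟩
    y + - y - x   ≈⟨ +-congʳ (-‿inverseʳ y) ⟩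
    0# + - x      ≈⟨ +-identityˡ (- x) ⟩
    - x           ∎
    where open ≤-Reasoning

  x<x+y : ∀ x {y} → 0# < y → x < x + y
  x<x+y x 0<y = ≤-<-trans (≤-reflexive (sym (+-identityʳ x))) (+-monoʳ-< x 0<y)

  -- If `1# ≤ 0#`, then `- 1#` is nonnegative, and so is its square `1#`.
  0<1 : 0# < 1#
  0<1 with total 0# 1#
  ... | inj₁ 0≤1 = 0≤1 , 0≉1
  ... | inj₂ 1≤0 = (begin
    0#             ≤⟨ *-nonNegative 0≤-1 0≤-1 ⟩
    - 1# * - 1#    ≈⟨ -‿distribˡ-* 1# (- 1#) ⟨
    - (1# * - 1#)  ≈⟨ -‿cong (*-identityˡ (- 1#)) ⟩
    - - 1#         ≈⟨ ⁻¹-involutive 1# ⟩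
    1#             ∎) , 0≉1
    where
    open ≤-Reasoning
    0≤-1 : 0# ≤ - 1#
    0≤-1 = begin
      0#        ≈⟨ -‿inverseʳ 1# ⟨
      1# - 1#   ≤⟨ +-monoˡ-≤ (- 1#) 1≤0 ⟩
      0# - 1#   ≈⟨ +-identityˡ (- 1#) ⟩
      - 1#      ∎

  halve : ∀ {e} → 0# < e → ∃[ d ] 0# < d × d + d ≈ e
  halve {e} (0≤e , 0≉e) with invertible (1# + 1#) 2≉0
    where
    2≉0 : ¬ 1# + 1# ≈ 0#
    2≉0 2≈0 = <⇒≱ (<-≤-trans 0<1 (<⇒≤ (x<x+y 1# 0<1))) (≤-reflexive 2≈0)
  ... | h , h*2≈1 , _ = h * e , (*-nonNegative 0≤h 0≤e , 0≉he) , he+he≈e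
    where
    open ≤-Reasoning
    h+h≈1 : h + h ≈ 1#
    h+h≈1 = trans (trans (+-cong (sym (*-identityʳ h)) (sym (*-identityʳ h))) (sym (distribˡ h 1# 1#))) h*2≈1
    he+he≈e : h * e + h * e ≈ e
    he+he≈e = trans (sym (distribʳ e h h)) (trans (*-congʳ h+h≈1) (*-identityˡ e))
    0≉he : ¬ 0# ≈ h * e
    0≉he eq = 0≉e (trans (sym (+-identityˡ 0#)) (trans (+-cong eq eq) he+he≈e))
    0≤h : 0# ≤ h
    0≤h with total 0# h
    ... | inj₁ 0≤h = 0≤h
    ... | inj₂ h≤0 = contradiction (begin
      1#       ≈⟨ h+h≈1 ⟨
      h + h    ≤⟨ +-mono-≤ h≤0 h≤0 ⟩
      0# + 0#  ≈⟨ +-identityˡ 0# ⟩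
      0#       ∎) (<⇒≱ 0<1)

  -- Half of the gap `y - x` can be given away while the inequality stays strict.
  slack : ∀ {x y} → x < y → ∃[ δ ] 0# < δ × x < y - δ
  slack {x} {y} x<y with halve 0<y-x
    where
    open ≤-Reasoning
    0<y-x : 0# < y - x
    0<y-x = begin-strict
      0#      ≈⟨ -‿inverseʳ x ⟨
      x - x   <⟨ +-monoˡ-< (- x) x<y ⟩
      y - x   ∎
  ... | δ , 0<δ , δ+δ≈y-x = δ , 0<δ , (begin-strict
    x                ≈⟨ +-identityʳ x ⟨
    x + 0#           <⟨ +-monoʳ-< x 0<δ ⟩
    x + δ            ≈⟨ x+y-y≈x (x + δ) δ ⟨
    x + δ + δ - δ    ≈⟨ +-congʳ (+-assoc x δ δ) ⟩
    x + (δ + δ) - δ  ≈⟨ +-congʳ (+-congˡ δ+δ≈y-x) ⟩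
    x + (y - x) - δ  ≈⟨ +-congʳ (+-assoc x y (- x)) ⟨
    x + y - x - δ    ≈⟨ +-congʳ (xyx⁻¹≈y x y) ⟩
    y - δ            ∎)
    where open ≤-Reasoning

  -- The smaller of two slacks serves both inequalities; `1#` is an arbitrary positive value for the
  -- empty list.
  uniformSlack : ∀ {a} {A : Set a} (h : A → Carrier) {x} {ys} → All (λ y → x < h y) ys →
                 ∃[ δ ] 0# < δ × All (λ y → x < h y - δ) ys
  uniformSlack h []            = 1# , 0<1 , []
  uniformSlack h (x<y ∷ x<ys) with slack x<y | uniformSlack h x<ys
  ... | δ , 0<δ , p | δ′ , 0<δ′ , ps with total δ δ′
  ... | inj₁ δ≤δ′ = δ , 0<δ , p ∷ All.map (λ q → <-≤-trans q (+-monoʳ-≤ _ (-‿anti-≤ δ≤δ′))) ps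
  ... | inj₂ δ′≤δ = δ′ , 0<δ′ , <-≤-trans p (+-monoʳ-≤ _ (-‿anti-≤ δ′≤δ)) ∷ ps

  minimum≤ : ∀ {x xs} → x ∈ˢ xs → minimum xs ≤ x
  minimum≤ {xs = x ∷ xs} (here ≡.refl)  = Extrema.min≤⊤ totalOrder x xs
  minimum≤ {xs = x ∷ xs} (there p) = All.lookup (Extrema.min≤xs totalOrder x xs) p

  ≤minimum : ∀ {v x xs} → x ∈ˢ xs → All (v ≤_) xs → v ≤ minimum xs
  ≤minimum {xs = _ ∷ _} _ (v≤x ∷ v≤xs) = Extrema.v≤min⁺ totalOrder v≤x v≤xs

  <minimum : ∀ {v x xs} → x ∈ˢ xs → All (v <_) xs → v < minimum xs
  <minimum {xs = _ ∷ _} _ (v<x ∷ v<xs) = Extrema.v<min⁺ totalOrder v<x v<xs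

  <∣∣ₖ⇒ : ∀ {v} x → v < ∣ x ∣ₖ → ¬ x < - v → v < x
  <∣∣ₖ⇒ {v} x v<∣x∣ x≮-v = ≰⇒> λ x≤v → <⇒≱ v<∣x∣ (Extrema.max≤v⁺ totalOrder x≤v (-x≤v ∷ []))
    where
    -x≤v : - x ≤ v
    -x≤v = ≤-trans (-‿anti-≤ (≮⇒≥ x≮-v)) (≤-reflexive (⁻¹-involutive v))

  -- Finite sums

  module _ {a} {A : Set a} where

    sum : List A → (A → Carrier) → Carrier
    sum xs f = foldr _+_ 0# (map f xs)

    sum-cong : ∀ xs {f g : A → Carrier} → (∀ x → f x ≈ g x) → sum xs f ≈ sum xs g
    sum-cong []       f≈g = refl
    sum-cong (x ∷ xs) f≈g = +-cong (f≈g x) (sum-cong xs f≈g)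

    sum-+ : ∀ xs (f g : A → Carrier) → sum xs (λ x → f x + g x) ≈ sum xs f + sum xs g
    sum-+ []       f g = sym (+-identityˡ 0#)
    sum-+ (x ∷ xs) f g = trans (+-congˡ (sum-+ xs f g)) (interchange (f x) (g x) (sum xs f) (sum xs g))

    sum-zero : ∀ {xs} {f : A → Carrier} → All (λ x → f x ≈ 0#) xs → sum xs f ≈ 0#
    sum-zero []         = refl
    sum-zero (fx≈0 ∷ p) = trans (+-cong fx≈0 (sum-zero p)) (+-identityˡ 0#)

    sum-single : ∀ {xs x} {f : A → Carrier} → Unique xs → x ∈ˢ xs →
                 (∀ {y} → y ≢ x → f y ≈ 0#) → sum xs f ≈ f x
    sum-single (x∉xs ∷ _) (here ≡.refl) z =
      trans (+-congˡ (sum-zero (All.map (λ x≢y → z (x≢y ∘ ≡.sym)) x∉xs))) (+-identityʳ _)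
    sum-single (y∉xs ∷ u) (there x∈xs) z =
      trans (+-cong (z (All.lookup y∉xs x∈xs)) (sum-single u x∈xs z)) (+-identityˡ _)

    sum-mono-≤ : ∀ xs {f g : A → Carrier} → (∀ x → f x ≤ g x) → sum xs f ≤ sum xs g
    sum-mono-≤ []       f≤g = ≤-refl
    sum-mono-≤ (x ∷ xs) f≤g = +-mono-≤ (f≤g x) (sum-mono-≤ xs f≤g)

    sum-mono-< : ∀ {xs x} {f g : A → Carrier} → (∀ x → f x ≤ g x) → x ∈ˢ xs → f x < g x →
                 sum xs f < sum xs g
    sum-mono-< {y ∷ xs} f≤g (here ≡.refl) fx<gx =
      <-≤-trans (+-monoˡ-< _ fx<gx) (+-monoʳ-≤ _ (sum-mono-≤ xs f≤g))
    sum-mono-< {y ∷ xs} f≤g (there p) fx<gx =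
      ≤-<-trans (+-monoˡ-≤ _ (f≤g y)) (+-monoʳ-< _ (sum-mono-< f≤g p fx<gx))

-- Reparameterizations

module Reparameterizations {c ℓ₁ ℓ₂} (K : OrderedField c ℓ₁ ℓ₂) {n : ℕ} (k : Fin n → ℕ)
         (F : List (Subset n)) (θ : Cost K k) where

  open OrderedField K
  open OrderedFieldProperties K
  open AbelianGroupProperties +-abelianGroup using (⁻¹-∙-comm; ε⁻¹≈ε; ⁻¹-involutive)
  open CommutativeSemigroupProperties +-commutativeSemigroup using (interchange)

  Item : Set
  Item = Σ (Subset n) (Labelling k)

  _≟ⁱ_ : (p q : Item) → Dec (p ≡ q)
  _≟ⁱ_ = Product.≡-dec _≟ˢ_ _≟ˡ_

  Multipliers : Set c
  Multipliers = ∀ (α β : Subset n) → Labelling k β → Carrier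

  if-[_⇒_] : ∀ {p} {P : Set p} → Dec P → (P → Carrier) → Carrier
  if-[_⇒_] = [_⇒_] K k

  if-zero : ∀ {p} {P : Set p} (P? : Dec P) {f} → (∀ p → f p ≈ 0#) → if-[ P? ⇒ f ] ≈ 0#
  if-zero (yes p) z = z p
  if-zero (no _)  z = refl

  if-yes : ∀ {p} {P : Set p} (P? : Dec P) {f v} → P → (∀ p → f p ≈ v) → if-[ P? ⇒ f ] ≈ v
  if-yes (yes p) _ e = e p
  if-yes (no ¬p) p e = contradiction p ¬p

  if-+ : ∀ {p} {P : Set p} (P? : Dec P) (f g : P → Carrier) →
         if-[ P? ⇒ (λ p → f p + g p) ] ≈ if-[ P? ⇒ f ] + if-[ P? ⇒ g ]
  if-+ (yes p) f g = refl
  if-+ (no _)  f g = sym (+-identityˡ 0#)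

  incoming outgoing : Multipliers → ∀ α → Labelling k α → Carrier
  incoming lam β x = Σ-subsets K k λ α → if-[ J? F α β ⇒ (λ _ → lam α β x) ]
  outgoing lam β x = Σ-subsets K k λ γ → if-[ J? F β γ ⇒ (λ j → lam β γ (restrict (J⇒⊆ {F = F} j) x)) ]

  R : Multipliers → Cost K k
  R lam = reparameterize K k F θ lam

  _⊕_ : Multipliers → Multipliers → Multipliers
  (lam ⊕ mu) α β x = lam α β x + mu α β x

  -- Reparameterization is affine in the multipliers, so a further move adds only its own net inflow
  -- to the costs reached so far.
  R-⊕ : ∀ lam mu α x → R (lam ⊕ mu) α x ≈ R lam α x + (incoming mu α x - outgoing mu α x)
  R-⊕ lam mu α x = begin
    θ α x + incoming (lam ⊕ mu) α x - outgoing (lam ⊕ mu) α x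
      ≈⟨ +-cong (+-congˡ in-⊕) (-‿cong out-⊕) ⟩
    θ α x + (a + b) - (p + q)
      ≈⟨ +-cong (+-assoc _ a b) (⁻¹-∙-comm p q) ⟨
    θ α x + a + b + (- p - q)
      ≈⟨ interchange (θ α x + a) b (- p) (- q) ⟩
    θ α x + a - p + (b - q) ∎
    where
    open ≤-Reasoning renaming (begin_ to begin-≤_; begin-equality_ to begin_)
    a = incoming lam α x
    b = incoming mu α x
    p = outgoing lam α x
    q = outgoing mu α x
    in-⊕ : incoming (lam ⊕ mu) α x ≈ a + b
    in-⊕ = trans (sum-cong (subsets n) (λ β → if-+ (J? F β α) _ _)) (sum-+ (subsets n) _ _)
    out-⊕ : outgoing (lam ⊕ mu) α x ≈ p + q
    out-⊕ = trans (sum-cong (subsets n) (λ β → if-+ (J? F α β) _ _)) (sum-+ (subsets n) _ _)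

  J-irrefl : ∀ {α β} → J F α β → α ≢ β
  J-irrefl (_ , _ , β⊂α , _) α≡β = ⊂-irref (≡.sym α≡β) β⊂α

  -- Moves the amount δ from the costs θ_α(x) with x_β = y to θ_β(y).
  module Bump (α β : Subset n) (y : Labelling k β) (δ : Carrier) where

    bump : Multipliers
    bump α′ β′ x = if-[ (α′ ≟ˢ α) ×-dec ((β′ , x) ≟ⁱ (β , y)) ⇒ (λ _ → δ) ]

    bump-zero : ∀ α′ β′ x → ¬ (α′ ≡ α × _≡_ {A = Item} (β′ , x) (β , y)) → bump α′ β′ x ≈ 0#
    bump-zero α′ β′ x ne = if-zero ((α′ ≟ˢ α) ×-dec ((β′ , x) ≟ⁱ (β , y))) (λ p → contradiction p ne)

    bump-δ : ∀ x → x ≡ y → bump α β x ≈ δ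
    bump-δ _ ≡.refl = if-yes ((α ≟ˢ α) ×-dec ((β , y) ≟ⁱ (β , y))) (≡.refl , ≡.refl) (λ _ → refl)

    incoming-zero : ∀ {γ x} → _≢_ {A = Item} (γ , x) (β , y) → incoming bump γ x ≈ 0#
    incoming-zero {γ} {x} ne = sum-zero (All.universal
      (λ α′ → if-zero (J? F α′ γ) (λ _ → bump-zero α′ γ x (ne ∘ proj₂))) (subsets n))

    incoming-δ : J F α β → incoming bump β y ≈ δ
    incoming-δ j = trans
      (sum-single (subsets-unique n) (∈-subsets α)
        (λ {α′} α′≢α → if-zero (J? F α′ β) (λ _ → bump-zero α′ β y (α′≢α ∘ proj₁))))
      (if-yes (J? F α β) j (λ _ → bump-δ y ≡.refl))

    outgoing-zero : ∀ {γ} f → ¬ (γ ≡ α × tab f β ≡ y) → outgoing bump γ (tab f γ) ≈ 0#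
    outgoing-zero {γ} f ne = sum-zero (All.universal
      (λ β′ → if-zero (J? F γ β′) (λ j →
        bump-zero γ β′ (restrict (J⇒⊆ {F = F} j) (tab f γ))
          λ (γ≡α , eq) → ne (γ≡α , restricted (J⇒⊆ {F = F} j) eq))) (subsets n))
      where
      restricted : ∀ {β′} (β′⊆γ : β′ ⊆ γ) →
                   _≡_ {A = Item} (β′ , restrict β′⊆γ (tab f γ)) (β , y) → tab f β ≡ y
      restricted β′⊆γ ≡.refl = ≡.sym (restrict-tab f β′⊆γ)

    outgoing-δ : J F α β → ∀ f → tab f β ≡ y → outgoing bump α (tab f α) ≈ δ
    outgoing-δ j f eq = trans
      (sum-single (subsets-unique n) (∈-subsets β)
        (λ {β′} β′≢β → if-zero (J? F α β′) (λ j′ →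
          bump-zero α β′ (restrict (J⇒⊆ {F = F} j′) (tab f α)) (β′≢β ∘ ≡.cong proj₁ ∘ proj₂))))
      (if-yes (J? F α β) j (λ j′ →
        bump-δ (restrict (J⇒⊆ {F = F} j′) (tab f α)) (≡.trans (restrict-tab f _) eq)))

    -- `J` relates distinct sets, so the one nonzero multiplier counts only as incoming at `β` and
    -- only as outgoing at `α`.
    R-lower : J F α β → ∀ lam f → tab f β ≡ y → R (lam ⊕ bump) β (tab f β) ≈ R lam β (tab f β) + δ
    R-lower j lam f ≡.refl = trans (R-⊕ lam bump β y) (+-congˡ (trans
      (+-cong (incoming-δ j) (trans (-‿cong (outgoing-zero f (λ p → J-irrefl j (≡.sym (proj₁ p))))) ε⁻¹≈ε))
      (+-identityʳ δ)))

    R-upper : J F α β → ∀ lam f → tab f β ≡ y → R (lam ⊕ bump) α (tab f α) ≈ R lam α (tab f α) - δ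
    R-upper j lam f eq = trans (R-⊕ lam bump α (tab f α)) (+-congˡ (trans
      (+-cong (incoming-zero (J-irrefl j ∘ ≡.cong proj₁)) (-‿cong (outgoing-δ j f eq)))
      (+-identityˡ (- δ))))

    R-elsewhere : ∀ lam f {γ} → ¬ (γ ≡ β × tab f β ≡ y) → ¬ (γ ≡ α × tab f β ≡ y) →
                  R (lam ⊕ bump) γ (tab f γ) ≈ R lam γ (tab f γ)
    R-elsewhere lam f {γ} ≢lower ≢upper = trans (R-⊕ lam bump γ (tab f γ)) (trans (+-congˡ (trans
      (+-cong (incoming-zero (≢lower ∘ tab-item)) (trans (-‿cong (outgoing-zero f ≢upper)) ε⁻¹≈ε))
      (+-identityʳ 0#))) (+-identityʳ _))

  -- Feasible multipliers and strict costs

  m : Subset n → Carrier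
  m α = minOver K k (θ α)

  m≤θ : ∀ {α} x → m α ≤ θ α x
  m≤θ {α} x = minimum≤ (∈-map⁺ (θ α) (∈-labellings x))

  -- Individual costs may decrease, but never below the original minimum of their factor, so the
  -- lower bound cannot drop.
  record State : Set (c ⊔ ℓ₂) where
    field
      lam      : Multipliers
      feasible : ∀ α f → m α ≤ R lam α (tab f α)

  open State

  record Strict (σ : State) (α : Subset n) (x : Labelling k α) : Set (ℓ₁ ⊔ ℓ₂) where
    constructor above
    field exceeds : m α < R (lam σ) α x

  open Strict public

  infix 4 _⊑_

  -- The size of an excess may shrink; only its being positive is preserved, and this is enough to
  -- chain improvements.
  record _⊑_ (σ τ : State) : Set (c ⊔ ℓ₁ ⊔ ℓ₂) where
    constructor mk⊑
    field strict : ∀ {α} f → Strict σ α (tab f α) → Strict τ α (tab f α)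

  open _⊑_ public

  Strict-⊑ : ∀ {σ τ α x} → σ ⊑ τ → Strict σ α x → Strict τ α x
  Strict-⊑ {σ} {τ} {α} {x} σ⊑τ s = ≡.subst (Strict τ α) (tab-◁ zeros x)
    (strict σ⊑τ (zeros ◁ x) (≡.subst (Strict σ α) (≡.sym (tab-◁ zeros x)) s))

  ⊑-refl : ∀ {σ} → σ ⊑ σ
  strict ⊑-refl f s = s

  ⊑-trans : ∀ {σ τ υ} → σ ⊑ τ → τ ⊑ υ → σ ⊑ υ
  strict (⊑-trans p q) f s = strict q f (strict p f s)

  Improve : ∀ {p} → State → (State → Set p) → Set (c ⊔ ℓ₁ ⊔ ℓ₂ ⊔ p)
  Improve σ P = ∃[ τ ] σ ⊑ τ × P τ

  improve-bind : ∀ {p q} {P : State → Set p} {Q : State → Set q} {σ} →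
                 Improve σ P → (∀ {τ} → σ ⊑ τ → P τ → Improve τ Q) → Improve σ Q
  improve-bind (τ , σ⊑τ , p) g with g σ⊑τ p
  ... | υ , τ⊑υ , q = υ , ⊑-trans σ⊑τ τ⊑υ , q

  -- The elements are treated one after another; monotonicity keeps the goals reached earlier true
  -- in later states.
  improve-all : ∀ {a g} {A : Set a} {G : State → A → Set g} →
                (∀ {σ τ x} → σ ⊑ τ → G σ x → G τ x) →
                ∀ σ (xs : List A) → (∀ {τ} → σ ⊑ τ → ∀ x → Improve τ (λ υ → G υ x)) →
                Improve σ (λ τ → All (G τ) xs)
  improve-all mono σ []       step = σ , ⊑-refl , []
  improve-all mono σ (x ∷ xs) step =
    improve-bind (step ⊑-refl x) λ {τ} σ⊑τ gx →
    improve-bind (improve-all mono τ xs (λ τ⊑υ → step (⊑-trans σ⊑τ τ⊑υ))) λ {υ} τ⊑υ gxs →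
    υ , ⊑-refl , mono τ⊑υ gx ∷ gxs

  R-0 : ∀ α x → R (λ _ _ _ → 0#) α x ≈ θ α x
  R-0 α x = trans
    (+-cong (trans (+-congˡ zero-in) (+-identityʳ _)) (trans (-‿cong zero-out) ε⁻¹≈ε))
    (+-identityʳ _)
    where
    zero-in : incoming (λ _ _ _ → 0#) α x ≈ 0#
    zero-in = sum-zero (All.universal (λ β → if-zero (J? F β α) (λ _ → refl)) (subsets n))
    zero-out : outgoing (λ _ _ _ → 0#) α x ≈ 0#
    zero-out = sum-zero (All.universal (λ β → if-zero (J? F α β) (λ _ → refl)) (subsets n))

  initial : State
  lam      initial α β x = 0#
  feasible initial α f   = ≤-trans (m≤θ (tab f α)) (≤-reflexive (sym (R-0 α (tab f α))))

  Strict-initial : ∀ {α x} → m α < θ α x → Strict initial α x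
  Strict-initial s = above (<-≤-trans s (≤-reflexive (sym (R-0 _ _))))

  -- Every cost touched by the move ends strictly above its minimum and all others are unchanged, so
  -- feasibility and strictness survive. The amount `δ` may have either sign.
  transfer : ∀ σ {α β} → J F α β → ∀ f δ →
             m β < R (lam σ) β (tab f β) + δ →
             (∀ g → tab g β ≡ tab f β → m α < R (lam σ) α (tab g α) - δ) →
             Improve σ λ τ → Strict τ β (tab f β) × (∀ g → tab g β ≡ tab f β → Strict τ α (tab g α))
  transfer σ {α} {β} j f δ lower upper = σ′ , mk⊑ grow , above (at-β f ≡.refl) , λ g eq → above (at-α g eq)
    where
    open Bump α β (tab f β) δ
    lam′ = lam σ ⊕ bump
    at-β : ∀ g → tab g β ≡ tab f β → m β < R lam′ β (tab g β)
    at-β g eq = <-≤-trans (≡.subst (λ x → m β < R (lam σ) β x + δ) (≡.sym eq) lower)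
                          (≤-reflexive (sym (R-lower j (lam σ) g eq)))
    at-α : ∀ g → tab g β ≡ tab f β → m α < R lam′ α (tab g α)
    at-α g eq = <-≤-trans (upper g eq) (≤-reflexive (sym (R-upper j (lam σ) g eq)))
    cases : ∀ γ g → m γ < R lam′ γ (tab g γ) ⊎ R lam′ γ (tab g γ) ≈ R (lam σ) γ (tab g γ)
    cases γ g = decide (tab g β ≟ˡ tab f β) (γ ≟ˢ β) (γ ≟ˢ α)
      where
      decide : Dec (tab g β ≡ tab f β) → Dec (γ ≡ β) → Dec (γ ≡ α) → _
      decide (yes eq) (yes ≡.refl) _            = inj₁ (at-β g eq)
      decide (yes eq) (no _)       (yes ≡.refl) = inj₁ (at-α g eq)
      decide (yes _)  (no γ≢β)     (no γ≢α)     = inj₂ (R-elsewhere (lam σ) g (γ≢β ∘ proj₁) (γ≢α ∘ proj₁))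
      decide (no ne)  _            _            = inj₂ (R-elsewhere (lam σ) g (ne ∘ proj₂) (ne ∘ proj₂))
    σ′ : State
    lam      σ′ = lam′
    feasible σ′ γ g = [ <⇒≤ , (λ eq → ≤-trans (feasible σ γ g) (≤-reflexive (sym eq))) ]′ (cases γ g)
    grow : ∀ {γ} g → Strict σ γ (tab g γ) → Strict σ′ γ (tab g γ)
    grow {γ} g s = above ([ id , (λ eq → <-≤-trans (exceeds s) (≤-reflexive (sym eq))) ]′ (cases γ g))

  -- A negative amount is transferred: half of the excess at `β` goes to all assignments of `α`
  -- extending `tab f β`, which were at least at the minimum and are now above it.
  push-up : ∀ σ {α β} → J F α β → ∀ f → Strict σ β (tab f β) →
            Improve σ λ τ → Strict τ α (tab f α)
  push-up σ {α} {β} j f s =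
    let δ , 0<δ , lower = slack (exceeds s)
    in improve-bind (transfer σ j f (- δ) lower (λ g _ → upper 0<δ g)) λ {τ} _ (_ , at-α) →
       τ , ⊑-refl , at-α f ≡.refl
    where
    upper : ∀ {δ} → 0# < δ → ∀ g → m α < R (lam σ) α (tab g α) - - δ
    upper {δ} 0<δ g = ≤-<-trans (feasible σ α g)
      (<-≤-trans (x<x+y _ 0<δ) (≤-reflexive (+-congˡ (sym (⁻¹-involutive δ)))))

  -- Raising one cost at `β` lowers all its extensions at `α` by the same amount; as these are
  -- finitely many and all strict, they have a common positive slack.
  push-down : ∀ σ {α β} → J F α β → ∀ f → (∀ g → tab g β ≡ tab f β → Strict σ α (tab g α)) →
              Improve σ λ τ → Strict τ β (tab f β)
  push-down σ {α} {β} j f s =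
    let δ , 0<δ , gaps = uniformSlack (R (lam σ) α) (All.map exceeds all-strict)
    in improve-bind (transfer σ j f δ (≤-<-trans (feasible σ β f) (x<x+y _ 0<δ)) (upper gaps))
         λ {τ} _ (at-β , _) →
       τ , ⊑-refl , at-β
    where
    β⊆α = J⇒⊆ {F = F} j
    matches? : ∀ x → Dec (restrict β⊆α x ≡ tab f β)
    matches? x = restrict β⊆α x ≟ˡ tab f β
    xs = filter matches? (labellings k α)
    all-strict : All (Strict σ α) xs
    all-strict = All.tabulate λ {x} x∈xs → ≡.subst (Strict σ α) (tab-◁ f x)
      (s (f ◁ x) (≡.trans (tab-restrict f x β⊆α) (proj₂ (∈-filter⁻ matches? {xs = labellings k α} x∈xs))))
    upper : ∀ {δ} → All (λ x → m α < R (lam σ) α x - δ) xs →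
            ∀ g → tab g β ≡ tab f β → m α < R (lam σ) α (tab g α) - δ
    upper gaps g eq = All.lookup gaps
      (∈-filter⁺ matches? (∈-labellings (tab g α)) (≡.trans (restrict-tab g β⊆α) eq))

  -- Gathering excess in a factor and projecting it

  Closed : Subset n → Set
  Closed τ = ∀ {β} → Nonempty β → β ⊆ τ → β ∈ˢ F

  -- The strict subset may vary with the assignment, which is why excess must be gathered at `τ`
  -- before it can be pushed down.
  Covered : State → Subset n → Assignment k → Set (ℓ₁ ⊔ ℓ₂)
  Covered σ τ f = ∃[ β ] Nonempty β × β ⊆ τ × Strict σ β (tab f β)

  Covered-⊑ : ∀ {σ τ α f} → σ ⊑ τ → Covered σ α f → Covered τ α f
  Covered-⊑ {f = f} σ⊑τ (β , ne , β⊆α , s) = β , ne , β⊆α , strict σ⊑τ f s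

  Covered-⊆ : ∀ {σ α α′ f} → α ⊆ α′ → Covered σ α f → Covered σ α′ f
  Covered-⊆ α⊆α′ (β , ne , β⊆α , s) = β , ne , ⊆-trans β⊆α α⊆α′ , s

  J-extend : ∀ {β i} → ⁅ i ⁆ ∪ β ∈ˢ F → β ∈ˢ F → i ∉ β → J F (⁅ i ⁆ ∪ β) β
  J-extend {β} {i} α∈F β∈F i∉β =
    α∈F , β∈F , (q⊆p∪q ⁅ i ⁆ β , i , p⊆p∪q β (x∈⁅x⁆ i) , i∉β) , ∣⁅i⁆∪p∣≡∣p∣+1 i∉β

  -- Excess climbs one node at a time, since `J` links sets whose sizes differ by one; `d` bounds
  -- the number of nodes still missing.
  lift : ∀ d σ {τ β} → Closed τ → Nonempty β → β ⊆ τ → ∣ τ ∣ ℕ.≤ ∣ β ∣ ℕ.+ d →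
         ∀ f → Strict σ β (tab f β) → Improve σ λ υ → Strict υ τ (tab f τ)
  lift d σ {τ} {β} closed ne β⊆τ size f s with Fin.any? (λ i → (i ∈? τ) ×-dec ¬? (i ∈? β))
  ... | no none = σ , ⊑-refl , ≡.subst (λ γ → Strict σ γ (tab f γ)) (⊆-antisym β⊆τ τ⊆β) s
    where
    τ⊆β : τ ⊆ β
    τ⊆β {i} i∈τ with i ∈? β
    ... | yes i∈β = i∈β
    ... | no  i∉β = contradiction (i , i∈τ , i∉β) none
  ... | yes (i , i∈τ , i∉β) with d
  ...   | ℕ.zero = contradiction size (ℕ.<⇒≱
    (≡.subst (ℕ._< ∣ τ ∣) (≡.sym (ℕ.+-identityʳ ∣ β ∣)) (p⊂q⇒∣p∣<∣q∣ (β⊆τ , i , i∈τ , i∉β))))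
  ...   | ℕ.suc d′ =
    improve-bind (push-up σ (J-extend (closed ne′ α⊆τ) (closed ne β⊆τ) i∉β) f s) λ {υ} _ s′ →
    lift d′ υ closed ne′ α⊆τ
      (ℕ.≤-trans size (ℕ.≤-reflexive
        (≡.trans (≡.sym (ℕ.+-assoc ∣ β ∣ 1 d′)) (≡.cong (ℕ._+ d′) (≡.sym (∣⁅i⁆∪p∣≡∣p∣+1 i∉β))))))
      f s′
    where
    ne′ : Nonempty (⁅ i ⁆ ∪ β)
    ne′ = i , p⊆p∪q β (x∈⁅x⁆ i)
    α⊆τ : ⁅ i ⁆ ∪ β ⊆ τ
    α⊆τ = ∪-least (⁅⁆-⊆ i∈τ) β⊆τ

  raise : ∀ σ {τ} → Closed τ → ∀ f → Covered σ τ f → Improve σ λ υ → Strict υ τ (tab f τ)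
  raise σ {τ} closed f (β , ne , β⊆τ , s) = lift ∣ τ ∣ σ closed ne β⊆τ (ℕ.m≤n+m ∣ τ ∣ ∣ β ∣) f s

  -- Each extension of `f` from `γ` to `τ` has excess somewhere inside `τ`; once all of it is raised
  -- to `τ`, it can be pushed down. By `split`, only `u` can be missing from `γ`, so one downward
  -- step suffices.
  project : ∀ σ {τ γ} u → Closed τ → Nonempty γ → γ ⊆ τ → (∀ {i} → i ∈ τ → i ≡ u ⊎ i ∈ γ) →
            ∀ f → (∀ g → Agree γ g f → Covered σ τ g) → Improve σ λ υ → Strict υ γ (tab f γ)
  project σ {τ} {γ} u closed ne γ⊆τ split f covered =
    improve-bind (improve-all {G = G} (λ σ⊑υ g eq → Strict-⊑ σ⊑υ (g eq)) σ (labellings k τ) step)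
      λ {υ} _ all →
    lower υ (λ g eq → All.lookup all (∈-labellings (tab g τ)) (≡.trans (restrict-tab g γ⊆τ) eq))
    where
    G : State → Labelling k τ → Set _
    G υ x = restrict γ⊆τ x ≡ tab f γ → Strict υ τ x
    step : ∀ {υ} → σ ⊑ υ → ∀ x → Improve υ (λ φ → G φ x)
    step {υ} σ⊑υ x with restrict γ⊆τ x ≟ˡ tab f γ
    -- Labellings that do not extend `f` satisfy `G` vacuously.
    ... | no ne = υ , ⊑-refl , λ eq → contradiction eq ne
    ... | yes eq = improve-bind (raise υ closed (f ◁ x) (Covered-⊑ σ⊑υ (covered (f ◁ x) agree)))
                   λ {φ} _ s → φ , ⊑-refl , λ _ → ≡.subst (Strict φ τ) (tab-◁ f x) s
      where
      agree : Agree γ (f ◁ x) f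
      agree = tab-injective (≡.trans (tab-restrict f x γ⊆τ) eq)
    lower : ∀ υ → (∀ g → tab g γ ≡ tab f γ → Strict υ τ (tab g τ)) → Improve υ λ φ → Strict φ γ (tab f γ)
    lower υ s with u ∈? τ ×-dec ¬? (u ∈? γ)
    ... | yes (u∈τ , u∉γ) = push-down υ (≡.subst (λ α → J F α γ) u∪γ≡τ (J-extend
        (≡.subst (_∈ˢ F) (≡.sym u∪γ≡τ) (closed (u , u∈τ) ⊆-refl)) (closed ne γ⊆τ) u∉γ)) f s
      where
      u∪γ≡τ : ⁅ u ⁆ ∪ γ ≡ τ
      u∪γ≡τ = ⊆-antisym (∪-least (⁅⁆-⊆ u∈τ) γ⊆τ)
        (λ i∈τ → [ (λ { ≡.refl → p⊆p∪q γ (x∈⁅x⁆ u) }) , q⊆p∪q ⁅ u ⁆ γ ] (split i∈τ))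
    -- Here `u` adds no node and `τ` equals `γ`, as for a degenerate triplet in which `u` is the
    -- fixed node.
    ... | no ¬p = υ , ⊑-refl , ≡.subst (λ α → Strict υ α (tab f α)) (⊆-antisym τ⊆γ γ⊆τ) (s f ≡.refl)
      where
      τ⊆γ : τ ⊆ γ
      τ⊆γ {i} i∈τ with split i∈τ | i ∈? γ
      ... | inj₂ i∈γ    | _       = i∈γ
      ... | inj₁ _      | yes i∈γ = i∈γ
      ... | inj₁ ≡.refl | no i∉γ  = contradiction (i∈τ , i∉γ) ¬p

-- Arc consistency

T-does⁻ : ∀ {p} {P : Set p} (P? : Dec P) → T (does P?) → P
T-does⁻ (yes p) _ = p

T-does⁺ : ∀ {p} {P : Set p} (P? : Dec P) → P → T (does P?)
T-does⁺ (yes _) _ = _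
T-does⁺ (no ¬p) p = ¬p p

¬T-if⁻ : ∀ {p} {P : Set p} (P? : Dec P) {b c} → ¬ T (if does P? then b else c) → (P × ¬ T b) ⊎ ¬ T c
¬T-if⁻ (yes p) ¬b = inj₁ (p , ¬b)
¬T-if⁻ (no _)  ¬c = inj₂ ¬c

module _ {n : ℕ} where

  ∣⁅i⁆∪p∣≤∣p∣+1 : ∀ (i : Fin n) p → ∣ ⁅ i ⁆ ∪ p ∣ ℕ.≤ ∣ p ∣ ℕ.+ 1
  ∣⁅i⁆∪p∣≤∣p∣+1 i p with i ∈? p
  ... | yes i∈p = ℕ.≤-trans (p⊆q⇒∣p∣≤∣q∣ (∪-least (⁅⁆-⊆ i∈p) ⊆-refl)) (ℕ.m≤m+n ∣ p ∣ 1)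
  ... | no  i∉p = ℕ.≤-reflexive (∣⁅i⁆∪p∣≡∣p∣+1 i∉p)

  ∣pair∣≤2 : ∀ (u v : Fin n) → ∣ pair u v ∣ ℕ.≤ 2
  ∣pair∣≤2 u v = ≡.subst (λ m → ∣ pair u v ∣ ℕ.≤ m ℕ.+ 1) (∣⁅x⁆∣≡1 v) (∣⁅i⁆∪p∣≤∣p∣+1 u ⁅ v ⁆)

  ∣triplet∣≤3 : ∀ (r u v : Fin n) → ∣ triplet r u v ∣ ℕ.≤ 3
  ∣triplet∣≤3 r u v = ℕ.≤-trans (∣⁅i⁆∪p∣≤∣p∣+1 r (pair u v)) (ℕ.+-monoˡ-≤ 1 (∣pair∣≤2 u v))

  ⊆∧∣∣≥⇒≡ : ∀ {p q : Subset n} → p ⊆ q → ∣ q ∣ ℕ.≤ ∣ p ∣ → p ≡ q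
  ⊆∧∣∣≥⇒≡ {p} {q} p⊆q ∣q∣≤∣p∣ = ⊆-antisym p⊆q q⊆p
    where
    q⊆p : q ⊆ p
    q⊆p {i} i∈q with i ∈? p
    ... | yes i∈p = i∈p
    ... | no  i∉p = contradiction ∣q∣≤∣p∣ (ℕ.<⇒≱ (p⊂q⇒∣p∣<∣q∣ (p⊆q , i , i∈q , i∉p)))

  -- A nonempty subset of a set of at most three nodes is a singleton, a pair or the whole set.
  small-closed : ∀ {F : List (Subset n)} {τ} → (∀ v → ⁅ v ⁆ ∈ˢ F) → τ ∈ˢ F → ∣ τ ∣ ℕ.≤ 3 →
                 (∀ {β} → β ⊆ τ → ∣ β ∣ ≡ 2 → β ∈ˢ F) → ∀ {β} → Nonempty β → β ⊆ τ → β ∈ˢ F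
  small-closed {F} {τ} singles τ∈F ∣τ∣≤3 pairs {β} (i , i∈β) β⊆τ with ∣ β ∣ ℕ.≤? 1 | ∣ β ∣ ℕ.≟ 2
  ... | yes ≤1 | _      = ≡.subst (_∈ˢ F)
      (⊆∧∣∣≥⇒≡ (⁅⁆-⊆ i∈β) (ℕ.≤-trans ≤1 (ℕ.≤-reflexive (≡.sym (∣⁅x⁆∣≡1 i))))) (singles i)
  ... | no _   | yes ≡2 = pairs β⊆τ ≡2
  ... | no ≰1  | no ≢2  = ≡.subst (_∈ˢ F)
      (≡.sym (⊆∧∣∣≥⇒≡ β⊆τ (ℕ.≤-trans ∣τ∣≤3 (ℕ.≤∧≢⇒< (ℕ.≰⇒> ≰1) (≢2 ∘ ≡.sym))))) τ∈F

  F⊆addTriplets : ∀ {F : List (Subset n)} A {α} → α ∈ˢ F → α ∈ˢ addTriplets F A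
  F⊆addTriplets A = ∈-++⁺ˡ

  triplet∈addTriplets : ∀ {F A : List (Subset n)} {τ} → τ ∈ˢ A → τ ∈ˢ addTriplets F A
  triplet∈addTriplets {F} τ∈A = ∈-++⁺ʳ F (∈-concatMap⁺ _ (Any.map (λ { ≡.refl → here ≡.refl }) τ∈A))

  pair∈addTriplets : ∀ {F A : List (Subset n)} {τ β} → τ ∈ˢ A → β ⊆ τ → ∣ β ∣ ≡ 2 → β ∈ˢ addTriplets F A
  pair∈addTriplets {F} {β = β} τ∈A β⊆τ ∣β∣≡2 = ∈-++⁺ʳ F (∈-concatMap⁺ _ (Any.map
    (λ { {τ} ≡.refl → there
      (∈-filter⁺ (λ β → (β ⊆? τ) ×-dec (∣ β ∣ ℕ.≟ 2)) (∈-subsets β) (β⊆τ , ∣β∣≡2)) }) τ∈A))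

-- From removals to strict costs

module Refutation {c ℓ₁ ℓ₂} (K : OrderedField c ℓ₁ ℓ₂) {n : ℕ} (k : Fin n → ℕ)
                  (F : List (Subset n)) (isFactorSet : IsFactorSet F) (A : List (Subset n))
                  (θ : Cost K k) where

  open OrderedField K
  open OrderedFieldProperties K
  open ArcConsistency k F
  open IsFactorSet isFactorSet
  open Reparameterizations K k (addTriplets F A) (extendByZero K k F θ)

  closed-⊆ : ∀ {p q} → p ⊆ q → Closed q → Closed p
  closed-⊆ p⊆q closed ne β⊆p = closed ne (⊆-trans β⊆p p⊆q)

  singleton-closed : ∀ v → Closed ⁅ v ⁆
  singleton-closed v = small-closed (F⊆addTriplets A ∘ singletons) (F⊆addTriplets A (singletons v))
    (ℕ.≤-trans (ℕ.≤-reflexive (∣⁅x⁆∣≡1 v)) (ℕ.s≤s ℕ.z≤n))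
    (λ {β} β⊆⁅v⁆ ≡2 → contradiction (p⊆q⇒∣p∣≤∣q∣ β⊆⁅v⁆)
      (ℕ.<⇒≱ (≡.subst₂ ℕ._<_ (≡.sym (∣⁅x⁆∣≡1 v)) (≡.sym ≡2) ℕ.≤-refl)))

  edge-closed : ∀ {τ} → Edge F τ → Closed τ
  edge-closed (τ∈F , ∣τ∣≡2) = small-closed (F⊆addTriplets A ∘ singletons) (F⊆addTriplets A τ∈F)
    (ℕ.≤-trans (ℕ.≤-reflexive ∣τ∣≡2) (ℕ.n≤1+n 2))
    (λ β⊆τ ∣β∣≡2 → ≡.subst (_∈ˢ addTriplets F A)
      (≡.sym (⊆∧∣∣≥⇒≡ β⊆τ (ℕ.≤-reflexive (≡.trans ∣τ∣≡2 (≡.sym ∣β∣≡2))))) (F⊆addTriplets A τ∈F))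

  triplet-closed : ∀ {τ} → τ ∈ˢ A → ∣ τ ∣ ℕ.≤ 3 → Closed τ
  triplet-closed τ∈A ∣τ∣≤3 =
    small-closed (F⊆addTriplets A ∘ singletons) (triplet∈addTriplets {F = F} τ∈A) ∣τ∣≤3
      (pair∈addTriplets {F = F} τ∈A)

  -- One treatment for both uses of arc consistency: `ρ` is empty for the initial run and the
  -- singleton of `r` for a run with `r` fixed.
  module Conditional (ρ : Subset n) (base : Assignment k) where

    record Invariant (I : CSP) (σ : State) : Set (ℓ₁ ⊔ ℓ₂) where
      field
        covered : ∀ {α} → α ∈ˢ F → ∀ f → Agree ρ f base → ¬ T (I α (tab f α)) →
                  Covered σ (ρ ∪ α) f

    open Invariant public

    Invariant-⊑ : ∀ {I σ τ} → σ ⊑ τ → Invariant I σ → Invariant I τ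
    covered (Invariant-⊑ σ⊑τ inv) α∈F f agree gone = Covered-⊑ σ⊑τ (covered inv α∈F f agree gone)

    -- A label removal projects from `ρ ∪ pair u v`, whose nonempty subsets must therefore be
    -- factors; a pair removal moves no cost.
    Available : Operation → Set
    Available (removePair u v x)  = ⊤
    Available (removeLabel u v a) = Edge F (pair u v) → Closed (ρ ∪ pair u v)

    removed⁻ : ∀ {α₀ x₀} I {α f} → ¬ T (remove (α₀ , x₀) I α (tab f α)) →
               (α ≡ α₀ × tab f α₀ ≡ x₀) ⊎ ¬ T (I α (tab f α))
    removed⁻ {α₀} {x₀} I {α} {f} gone with (α , tab f α) ≟ᴵ (α₀ , x₀)
    ... | yes eq = inj₁ (tab-item eq)
    ... | no  _ with I α (tab f α)
    ...   | true  = contradiction tt gone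
    ...   | false = inj₂ id

    gone-label : ∀ {I σ} → Invariant I σ → ∀ {v} f → Agree ρ f base → ¬ Dom I v (f v) →
                 Covered σ (ρ ∪ ⁅ v ⁆) f
    gone-label {I} inv {v} f agree ¬dom =
      covered inv (singletons v) f agree (¬dom ∘ ≡.subst (T ∘ I ⁅ v ⁆) (tab-⁅⁆ f v))

    -- The excess explaining the missing label of `u` lies inside `ρ ∪ ⁅ u ⁆`, hence inside
    -- `ρ ∪ pair u v`.
    preserve-removePair : ∀ {I σ u v x} → Enabled I (removePair u v x) → Invariant I σ →
                          Invariant (apply (removePair u v x) I) σ
    covered (preserve-removePair {I} {u = u} {v} {x} (removePair _ _ ¬dom) inv) α∈F f agree gone
      with removed⁻ I {f = f} gone
    ... | inj₂ gone′ = covered inv α∈F f agree gone′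
    ... | inj₁ (≡.refl , ≡.refl) = Covered-⊆
        (∪-least (p⊆p∪q (pair u v)) (⊆-trans (p⊆p∪q {p = ⁅ u ⁆} ⁅ v ⁆) (q⊆p∪q ρ (pair u v))))
        (gone-label inv f agree (¬dom ∘ ≡.subst (Dom I u) (≡.sym (lookup-tab f (first∈pair u v)))))

    -- As `a` lacks support, all pairs containing it are gone, so the invariant covers every
    -- compatible assignment with `a` at `v` inside `ρ ∪ pair u v`; projecting `u` away puts the
    -- excess on `ρ ∪ ⁅ v ⁆`.
    preserve-removeLabel : ∀ {I σ u v a} → Enabled I (removeLabel u v a) →
                           Available (removeLabel u v a) → Invariant I σ →
                           Improve σ (Invariant (apply (removeLabel u v a) I))
    preserve-removeLabel {I} {σ} {u} {v} {a} (removeLabel edge _ unsupported) available inv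
      with (v ∈? ρ) →-dec (base v Fin.≟ a)
    -- If `v` lies in `ρ` with another base label, no assignment agreeing with `base` takes `a` at
    -- `v`, so no cost has to move.
    ... | no incompatible = σ , ⊑-refl , inv′
      where
      inv′ : Invariant (apply (removeLabel u v a) I) σ
      covered inv′ α∈F f agree gone with removed⁻ I {f = f} gone
      ... | inj₂ gone′ = covered inv α∈F f agree gone′
      ... | inj₁ (_ , eq) = contradiction (λ v∈ρ → ≡.trans (≡.sym (agree v∈ρ)) (tab-⁅⁆⁻ f eq)) incompatible
    ... | yes compatible =
      improve-bind (project σ u (available edge) (v , v∈γ) γ⊆τ split f₀ f₀-covered) λ {τ} σ⊑τ s →
      τ , ⊑-refl , inv′ (Invariant-⊑ σ⊑τ inv) s
      where
      γ = ρ ∪ ⁅ v ⁆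
      f₀ = base [ v ≔ a ]
      v∈γ : v ∈ γ
      v∈γ = q⊆p∪q ρ ⁅ v ⁆ (x∈⁅x⁆ v)
      γ⊆τ : γ ⊆ ρ ∪ pair u v
      γ⊆τ = ∪-least (p⊆p∪q (pair u v)) (⊆-trans (q⊆p∪q ⁅ u ⁆ ⁅ v ⁆) (q⊆p∪q ρ (pair u v)))
      split : ∀ {i} → i ∈ ρ ∪ pair u v → i ≡ u ⊎ i ∈ γ
      split i∈τ with x∈p∪q⁻ ρ (pair u v) i∈τ
      ... | inj₁ i∈ρ = inj₂ (p⊆p∪q ⁅ v ⁆ i∈ρ)
      ... | inj₂ i∈uv with x∈p∪q⁻ ⁅ u ⁆ ⁅ v ⁆ i∈uv
      ...   | inj₁ i∈u = inj₁ (x∈⁅y⁆⇒x≡y u i∈u)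
      ...   | inj₂ i∈v = inj₂ (q⊆p∪q ρ ⁅ v ⁆ i∈v)
      f₀-agree : Agree ρ f₀ base
      f₀-agree {i} i∈ρ with i Fin.≟ v
      ... | yes ≡.refl = ≡.trans (≔-updates base v a) (≡.sym (compatible i∈ρ))
      ... | no i≢v     = ≔-minimal base a i≢v
      f₀-covered : ∀ g → Agree γ g f₀ → Covered σ (ρ ∪ pair u v) g
      f₀-covered g agree = covered inv (proj₁ edge) g
        (λ i∈ρ → ≡.trans (agree (p⊆p∪q ⁅ v ⁆ i∈ρ)) (f₀-agree i∈ρ))
        (unsupported (tab g (pair u v))
          (≡.trans (lookup-tab g (second∈pair u v)) (≡.trans (agree v∈γ) (≔-updates base v a))))
      inv′ : ∀ {τ} → Invariant I τ → Strict τ γ (tab f₀ γ) → Invariant (apply (removeLabel u v a) I) τ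
      covered (inv′ {τ} inv s) α∈F f agree gone with removed⁻ I {f = f} gone
      ... | inj₂ gone′ = covered inv α∈F f agree gone′
      ... | inj₁ (≡.refl , eq) =
        γ , (v , v∈γ) , ⊆-refl , ≡.subst (Strict τ γ) (tab-cong same) s
        where
        same : Agree γ f₀ f
        same {i} i∈γ with i Fin.≟ v | x∈p∪q⁻ ρ ⁅ v ⁆ i∈γ
        ... | yes ≡.refl | _        = ≡.trans (≔-updates base v a) (≡.sym (tab-⁅⁆⁻ f eq))
        ... | no i≢v     | inj₁ i∈ρ = ≡.trans (≔-minimal base a i≢v) (≡.sym (agree i∈ρ))
        ... | no i≢v     | inj₂ i∈v = contradiction (x∈⁅y⁆⇒x≡y v i∈v) i≢v

    preserve-run : ∀ {I os I′} → Run I os I′ → All Available os → ∀ σ → Invariant I σ →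
                   Improve σ (Invariant I′)
    preserve-run [] _ σ inv = σ , ⊑-refl , inv
    preserve-run {os = removePair u v x ∷ _} ((_ , enabled) ∷ run) (_ ∷ av) σ inv =
      preserve-run run av σ (preserve-removePair enabled inv)
    preserve-run {os = removeLabel u v a ∷ _} ((_ , enabled) ∷ run) (available ∷ av) σ inv =
      improve-bind (preserve-removeLabel enabled available inv) λ {τ} _ inv′ →
      preserve-run run av τ inv′

  module Unconditional = Conditional ∅ zeros
  module Fixing {r} (s : Label k r) = Conditional ⁅ r ⁆ (zeros [ r ≔ s ])

  edges-available : ∀ os → All Unconditional.Available os
  edges-available [] = []
  edges-available (removePair u v x ∷ os) = tt ∷ edges-available os
  edges-available (removeLabel u v a ∷ os) =
    (λ edge → ≡.subst Closed (≡.sym (∪-identityˡ (pair u v))) (edge-closed edge)) ∷ edges-available os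

  triplets-available : ∀ {r} (s : Label k r) os → (∀ {τ} → τ ∈ˢ deletionTriplets r os → τ ∈ˢ A) →
                       All (Fixing.Available s) os
  triplets-available s [] _ = []
  triplets-available s (removePair u v x ∷ os) ⊆A = tt ∷ triplets-available s os ⊆A
  triplets-available {r} s (removeLabel u v a ∷ os) ⊆A =
    (λ _ → triplet-closed (⊆A (here ≡.refl)) (∣triplet∣≤3 r u v)) ∷ triplets-available s os (⊆A ∘ there)

  -- What fixing removes are labels of `r` other than `s`, which no assignment agreeing with the
  -- base takes; everything else was already missing from `I`.
  fix-invariant : ∀ {I σ r} (s : Label k r) → Unconditional.Invariant I σ →
                  Fixing.Invariant s (fix r s I) σ
  Fixing.Invariant.covered (fix-invariant {r = r} s inv) {α} α∈F f agree gone
    with ¬T-if⁻ (α ≟ˢ ⁅ r ⁆) gone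
  ... | inj₂ gone′ = Covered-⊆ (≡.subst (_⊆ ⁅ r ⁆ ∪ α) (≡.sym (∪-identityˡ α)) (q⊆p∪q ⁅ r ⁆ α))
                 (Unconditional.covered inv α∈F f (λ i∈∅ → contradiction i∈∅ ∉⊥) gone′)
  ... | inj₁ (≡.refl , gone′) = contradiction (T-does⁺ ((⁅ r ⁆ , tab f ⁅ r ⁆) ≟ᴵ (⁅ r ⁆ , single r s))
                       (≡.cong (⁅ r ⁆ ,_) (≡.trans (tab-⁅⁆ f r)
                         (≡.cong (single r) (≡.trans (agree (x∈⁅x⁆ r)) (≔-updates zeros r s)))))) gone′

  -- If the emptied node differs from `r`, the closing triplet `triplet r v r` supplies the pair
  -- needed for the last projection; otherwise the singleton of `r` suffices.
  associated-split : ∀ r v os → (∀ {τ} → τ ∈ˢ associatedTriplets r v os → τ ∈ˢ A) →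
                     (∀ {τ} → τ ∈ˢ deletionTriplets r os → τ ∈ˢ A) × Closed (⁅ r ⁆ ∪ ⁅ v ⁆)
  associated-split r v os ⊆A with v Fin.≟ r
  ... | yes ≡.refl = ⊆A , closed-⊆ (∪-least ⊆-refl ⊆-refl) (singleton-closed r)
  ... | no _ = (λ τ∈ → ⊆A (∈-++⁺ˡ τ∈)) ,
      closed-⊆ (∪-least (p⊆p∪q (pair v r)) (⊆-trans (p⊆p∪q {p = ⁅ v ⁆} ⁅ r ⁆) (q⊆p∪q ⁅ r ⁆ (pair v r))))
        (triplet-closed (⊆A (∈-++⁺ʳ (deletionTriplets r os) (here ≡.refl))) (∣triplet∣≤3 r v r))

  -- All labels of the emptied node `v` are gone, so every assignment with `s` at `r` is covered
  -- inside `⁅ r ⁆ ∪ ⁅ v ⁆`; projecting `v` away leaves the excess at `r`. A nonempty `B` excludes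
  -- the consistent outcome.
  refute : ∀ {I r s B} → Search I r s B → B ≢ [] → (∀ {τ} → τ ∈ˢ B → τ ∈ˢ A) →
           ∀ σ → Unconditional.Invariant I σ → Improve σ (λ τ → Strict τ ⁅ r ⁆ (single r s))
  refute (consistent _ _) B≢[] _ σ inv = contradiction ≡.refl B≢[]
  refute {I} {r} {s} (inconsistent {os} {I′} {v} run empty _) _ ⊆A σ inv =
    let ⊆A′ , closed = associated-split r v os ⊆A in
    improve-bind (preserve-run run (triplets-available s os ⊆A′) σ (fix-invariant s inv)) λ {τ} _ inv′ →
    improve-bind (project τ v closed (r , x∈⁅x⁆ r) (p⊆p∪q ⁅ v ⁆) split base (base-covered inv′))
      λ {υ} _ strict →
    υ , ⊑-refl , ≡.subst (Strict υ ⁅ r ⁆) (tab-◁ zeros (single r s)) strict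
    where
    open Fixing s
    base = zeros [ r ≔ s ]
    split : ∀ {i} → i ∈ ⁅ r ⁆ ∪ ⁅ v ⁆ → i ≡ v ⊎ i ∈ ⁅ r ⁆
    split i∈ with x∈p∪q⁻ ⁅ r ⁆ ⁅ v ⁆ i∈
    ... | inj₁ i∈r = inj₂ i∈r
    ... | inj₂ i∈v = inj₁ (x∈⁅y⁆⇒x≡y v i∈v)
    base-covered : ∀ {τ} → Invariant I′ τ → ∀ g → Agree ⁅ r ⁆ g base → Covered τ (⁅ r ⁆ ∪ ⁅ v ⁆) g
    base-covered inv′ g agree = gone-label inv′ g agree (empty (g v))

  Refutable : CSP → ∀ r → Label k r → Set
  Refutable I r s = Dom I r s → ∃[ B ] Search I r s B × B ≢ [] × (∀ {τ} → τ ∈ˢ B → τ ∈ˢ A)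

  refute-label : ∀ {I r} (s : Label k r) → Refutable I r s →
                 ∀ σ → Unconditional.Invariant I σ → Improve σ (λ τ → Strict τ ⁅ r ⁆ (single r s))
  refute-label {I} {r} s searches σ inv with T? (I ⁅ r ⁆ (single r s))
  ... | yes dom = let _ , search , B≢[] , ⊆A = searches dom in refute search B≢[] ⊆A σ inv
  -- The label is missing before anything is fixed, so the unconditional invariant covers it; this
  -- projection drops no node.
  ... | no ¬dom =
    improve-bind (project σ r (singleton-closed r) (r , x∈⁅x⁆ r) ⊆-refl inj₂ base covered) λ {υ} _ strict →
    υ , ⊑-refl , ≡.subst (Strict υ ⁅ r ⁆) (tab-◁ zeros (single r s)) strict
    where
    base = zeros [ r ≔ s ]
    covered : ∀ g → Agree ⁅ r ⁆ g base → Covered σ ⁅ r ⁆ g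
    covered g agree = Covered-⊆ (∪-least ⊥⊆ ⊆-refl)
      (Unconditional.gone-label inv g (λ i∈∅ → contradiction i∈∅ ∉⊥)
        (¬dom ∘ ≡.subst (Dom I r) (≡.trans (agree (x∈⁅x⁆ r)) (≔-updates zeros r s))))

  refute-node : ∀ {I r} → (∀ s → Refutable I r s) →
                ∀ σ → Unconditional.Invariant I σ →
                Improve σ (λ τ → ∀ s → Strict τ ⁅ r ⁆ (single r s))
  refute-node {I} {r} searches σ inv =
    improve-bind (improve-all Strict-⊑ σ (allFin _)
      (λ σ⊑τ s → refute-label s (searches s) _ (Unconditional.Invariant-⊑ σ⊑τ inv))) λ {τ} _ all →
    τ , ⊑-refl , λ s → All.lookup all (∈-allFin s)

  -- Increase of the lower bound

  module _ (ε : Carrier) (0<ε : 0# < ε) where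

    I₀ : CSP
    I₀ = initialCSP K k F θ ε

    -- The membership decision is a variable so that a case split computes under the minimum.
    m-extend : ∀ {α} (d : Dec (α ∈ˢ F)) → α ∈ˢ F →
               minOver K k {α} (λ x → [_⇒_] K k d (λ _ → θ α x)) ≡ minOver K k (θ α)
    m-extend (yes _) _   = ≡.refl
    m-extend (no ¬p) α∈F = contradiction α∈F ¬p

    θ-extend : ∀ {α} (d : Dec (α ∈ˢ F)) → α ∈ˢ F → ∀ x → [_⇒_] K k d (λ _ → θ α x) ≡ θ α x
    θ-extend (yes _) _   x = ≡.refl
    θ-extend (no ¬p) α∈F x = contradiction α∈F ¬p

    -- A labelling outside the initial relation costs more than the minimum plus `ε`, so its own
    -- factor is already strict at it.
    initial-invariant : Unconditional.Invariant I₀ initial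
    Unconditional.Invariant.covered initial-invariant {α} α∈F f _ gone =
      α , IsFactorSet.nonempty isFactorSet α∈F , q⊆p∪q ∅ α ,
      Strict-initial (≡.subst₂ _<_
        (≡.sym (m-extend (α ∈ˢ? F) α∈F)) (≡.sym (θ-extend (α ∈ˢ? F) α∈F (tab f α)))
        (≤-<-trans (<⇒≤ (x<x+y _ 0<ε)) (≰⇒> (gone ∘ T-does⁺ (θ α (tab f α) ≤? minOver K k (θ α) + ε)))))

    -- By feasibility no minimum falls below the old one, which is zero on added factors. At `r`
    -- every label is strict, hence so is the minimum over its finitely many labels.
    bound-increases : ∀ {r} σ → (∀ s → Strict σ ⁅ r ⁆ (single r s)) →
                      Φ K k F θ < Φ K k (addTriplets F A) (R (State.lam σ))
    bound-increases {r} σ strict = sum-mono-<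
        (λ α → summand (F⊆addTriplets A) (α ∈ˢ? addTriplets F A)) (∈-subsets ⁅ r ⁆)
        (summand-< (⁅ r ⁆ ∈ˢ? addTriplets F A) (F⊆addTriplets A (singletons r)))
      where
      θ̄ = R (State.lam σ)
      m≤min : ∀ α → m α ≤ minOver K k (θ̄ α)
      m≤min α = ≤minimum (∈-map⁺ (θ̄ α) (∈-labellings (tab zeros α)))
        (All.map⁺ (All.universal (λ x →
          ≡.subst (λ x → m α ≤ θ̄ α x) (tab-◁ zeros x) (State.feasible σ α (zeros ◁ x))) _))
      old≤m : ∀ {α} (d : Dec (α ∈ˢ F)) →
              [_⇒_] K k d (λ _ → minOver K k (θ α)) ≤
              minOver K k {α} (λ x → [_⇒_] K k d (λ _ → θ α x))
      old≤m (yes _) = ≤-refl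
      old≤m {α} (no _) = ≤minimum (∈-map⁺ (λ _ → 0#) (∈-labellings (tab zeros α)))
        (All.map⁺ (All.universal (λ _ → ≤-refl) (labellings k α)))
      out : ∀ {α} (d : Dec (α ∈ˢ F)) → ¬ α ∈ˢ F → [_⇒_] K k d (λ _ → minOver K k (θ α)) ≤ 0#
      out (yes p) ¬p = contradiction p ¬p
      out (no _)  _  = ≤-refl
      m<min : m ⁅ r ⁆ < minOver K k (θ̄ ⁅ r ⁆)
      m<min = <minimum (∈-map⁺ (θ̄ ⁅ r ⁆) (∈-labellings (tab zeros ⁅ r ⁆)))
        (All.map⁺ (All.universal (λ x → ≡.subst (Strict σ ⁅ r ⁆)
          (≡.trans (≡.sym (tab-⁅⁆ (zeros ◁ x) r)) (tab-◁ zeros x)) (strict ((zeros ◁ x) r)) .exceeds) _))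
      summand : ∀ {α} → (α ∈ˢ F → α ∈ˢ addTriplets F A) → (d : Dec (α ∈ˢ addTriplets F A)) →
                [_⇒_] K k (α ∈ˢ? F) (λ _ → minOver K k (θ α)) ≤ [_⇒_] K k d (λ _ → minOver K k (θ̄ α))
      summand {α} _  (yes _) = ≤-trans (old≤m (α ∈ˢ? F)) (m≤min α)
      summand {α} F⊆ (no ∉)  = out (α ∈ˢ? F) (∉ ∘ F⊆)
      summand-< : (d : Dec (⁅ r ⁆ ∈ˢ addTriplets F A)) → ⁅ r ⁆ ∈ˢ addTriplets F A →
                  [_⇒_] K k (⁅ r ⁆ ∈ˢ? F) (λ _ → minOver K k (θ ⁅ r ⁆)) <
                  [_⇒_] K k d (λ _ → minOver K k (θ̄ ⁅ r ⁆))
      summand-< (yes _) _ = ≤-<-trans (old≤m (⁅ r ⁆ ∈ˢ? F)) m<min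
      summand-< (no ∉)  p = contradiction p ∉

    increase : ∀ {os I} → Run I₀ os I → ∀ {r} → (∀ s → Refutable I r s) →
               ∃[ θ̄ ] IsReparameterization K k (addTriplets F A) (extendByZero K k F θ) θ̄
                      × Φ K k F θ < Φ K k (addTriplets F A) θ̄
    increase {os} run searches =
      let τ , _ , inv = Unconditional.preserve-run run (edges-available os) initial initial-invariant
          υ , _ , strict = refute-node searches τ inv
      in R (State.lam υ) , (State.lam υ , λ _ _ → refl) , bound-increases υ strict

-- Frustrated cycles

T-if⁺ : ∀ {p} {P : Set p} (P? : Dec P) {b c} → P → T b → T (if does P? then b else c)
T-if⁺ (yes _) _ b = b
T-if⁺ (no ¬p) p _ = contradiction p ¬p

T-if-then⁻ : ∀ {p} {P : Set p} (P? : Dec P) {b c} → P → T (if does P? then b else c) → T b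
T-if-then⁻ (yes _) _ b = b
T-if-then⁻ (no ¬p) p _ = contradiction p ¬p

T-if-else⁻ : ∀ {p} {P : Set p} (P? : Dec P) {b c} → ¬ P → T (if does P? then b else c) → T c
T-if-else⁻ (yes p) ¬p _ = contradiction p ¬p
T-if-else⁻ (no _)  _  c = c

T-∧⁻ˡ : ∀ {b c} → T (b ∧ c) → T b
T-∧⁻ˡ {true} _ = tt

T-∧-not⁺ : ∀ {p} {P : Set p} (P? : Dec P) {b} → ¬ P → T b → T (b ∧ not (does P?))
T-∧-not⁺ (yes p) ¬p b = contradiction p ¬p
T-∧-not⁺ (no _) {true} _ b = tt

flip-if : ∀ {p} {P : Set p} → Dec P → Bool → Bool
flip-if P? b = if does P? then not b else b

-- The side reached from `b` after crossing the given number of negative edges.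
flips : ℕ → Bool → Bool
flips ℕ.zero    b = b
flips (ℕ.suc m) b = flips m (not b)

flips-filter : ∀ {a p} {A : Set a} {P : A → Set p} (P? : ∀ x → Dec (P x)) x xs b →
               flips (length (filter P? xs)) (flip-if (P? x) b) ≡ flips (length (filter P? (x ∷ xs))) b
flips-filter P? x xs b with does (P? x)
... | true  = ≡.refl
... | false = ≡.refl

flips-odd : ∀ m b → m % 2 ≡ 1 → flips m b ≡ not b
flips-odd (ℕ.suc ℕ.zero)      b _   = ≡.refl
flips-odd (ℕ.suc (ℕ.suc m)) b odd =
  ≡.trans (flips-odd m (not (not b)) odd) (≡.cong not (Bool.not-involutive b))

module _ {n : ℕ} where

  edge-distinct : ∀ {u v : Fin n} → ∣ pair u v ∣ ≡ 2 → u ≢ v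
  edge-distinct {u} ≡2 ≡.refl =
    contradiction
      (≡.subst₂ ℕ._≤_ ≡2 (∣⁅x⁆∣≡1 u) (p⊆q⇒∣p∣≤∣q∣ {p = pair u u} {⁅ u ⁆} (∪-least ⊆-refl ⊆-refl)))
      λ { (ℕ.s≤s ()) }

  singleton≢edge : ∀ {v : Fin n} {α} → ∣ α ∣ ≡ 2 → ⁅ v ⁆ ≢ α
  singleton≢edge {v} ≡2 ≡.refl with () ← ≡.trans (≡.sym ≡2) (∣⁅x⁆∣≡1 v)

-- Effects of fixing a label and of running arc consistency

module ArcConsistencyProperties {n : ℕ} (k : Fin n → ℕ) (F : List (Subset n)) where

  open ArcConsistency k F

  run-shrinks : ∀ {I os I′} → Run I os I′ → ∀ {α x} → T (I′ α x) → T (I α x)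
  run-shrinks []                                       t = t
  run-shrinks (_∷_ {o = removePair _ _ _} _ run)  t = T-∧⁻ˡ (run-shrinks run t)
  run-shrinks (_∷_ {o = removeLabel _ _ _} _ run) t = T-∧⁻ˡ (run-shrinks run t)

  fix-self : ∀ {I} r s → Dom (fix r s I) r s
  fix-self r s = T-if⁺ (⁅ r ⁆ ≟ˢ ⁅ r ⁆) ≡.refl (T-does⁺ ((⁅ r ⁆ , single r s) ≟ᴵ (⁅ r ⁆ , single r s)) ≡.refl)

  fix-unique : ∀ {I} r {s a} → Dom (fix r s I) r a → a ≡ s
  fix-unique r {s} {a} dom = single-injective {k = k} {r} (at-r
    (T-does⁻ ((⁅ r ⁆ , single r a) ≟ᴵ (⁅ r ⁆ , single r s)) (T-if-then⁻ (⁅ r ⁆ ≟ˢ ⁅ r ⁆) ≡.refl dom)))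
    where
    at-r : ∀ {x} → _≡_ {A = Σ (Subset n) (Labelling k)} (⁅ r ⁆ , single r a) (⁅ r ⁆ , x) →
           single r a ≡ x
    at-r ≡.refl = ≡.refl

  fix-elsewhere : ∀ {I} r s {α x} → α ≢ ⁅ r ⁆ → T (fix r s I α x) → T (I α x)
  fix-elsewhere r s {α} α≢⁅r⁆ = T-if-else⁻ (α ≟ˢ ⁅ r ⁆) α≢⁅r⁆

  -- Every label removal produces a triplet, and a pair removal acts on a two-element set, so it
  -- cannot touch a singleton.
  labels-kept : ∀ {I os I′ r} → Run I os I′ → deletionTriplets r os ≡ [] → ∀ {v a} → Dom I v a → Dom I′ v a
  labels-kept [] _ dom = dom
  labels-kept (_∷_ {o = removePair u v x} (_ , removePair (_ , ≡2) _ _) run) none {v′} {a} dom =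
    labels-kept run none (T-∧-not⁺ ((⁅ v′ ⁆ , single v′ a) ≟ᴵ (pair u v , x))
      (singleton≢edge ≡2 ∘ ≡.cong proj₁) dom)
  labels-kept (_∷_ {o = removeLabel _ _ _} _ _) () dom

  -- If `r` itself is emptied, then `s`, present after fixing, was deleted and left a triplet;
  -- otherwise the closing triplet is there.
  associated≢[] : ∀ {I os I′ r s v} → Run (fix r s I) os I′ → EmptyAt I′ v → associatedTriplets r v os ≢ []
  associated≢[] {I} {os} {r = r} {s} {v} run empty eq with v Fin.≟ r
  ... | yes ≡.refl = empty s (labels-kept run eq (fix-self {I} r s))
  ... | no _ with () ← List.++-conicalʳ (deletionTriplets r os) _ eq

-- Sides of the partitions along a cycle

module FrustratedCycleProperties {c ℓ₁ ℓ₂} (K : OrderedField c ℓ₁ ℓ₂) {n : ℕ} (k : Fin n → ℕ)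
         (F : List (Subset n)) (θ : Cost K k) (ε : OrderedField.Carrier K)
         (0<ε : OrderedField._<_ K (OrderedField.0# K) ε) where

  open OrderedField K
  open OrderedFieldProperties K
  open AbelianGroupProperties +-abelianGroup using (⁻¹-involutive; ⁻¹-anti-homo‿-; ε⁻¹≈ε)
  open PartitionGraph K k F θ ε
  open ArcConsistency k F
  open ArcConsistencyProperties k F
  open _∈Π

  I₀ : CSP
  I₀ = initialCSP K k F θ ε

  side : (π : Partition) → Label k (proj₁ π) → Bool
  side (_ , π⁺) a = does (a ∈? π⁺)

  -- A near-minimal `x` satisfying `P` would bring the minimum over `P` within `ε` of that over `Q`.
  -- The witness `y` keeps the list for `Q` nonempty, so that its minimum is not the default value.
  near⇒¬ : ∀ {α} {P Q : Labelling k α → Set} (P? : ∀ x → Dec (P x)) (Q? : ∀ x → Dec (Q x))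
           {y} → Q y →
           ε < minimum (map (θ α) (filter P? (labellings k α)))
             - minimum (map (θ α) (filter Q? (labellings k α))) →
           ∀ {x} → T (I₀ α x) → ¬ P x
  near⇒¬ {α} P? Q? {y} Qy ε<gap {x} near Px = <⇒≱ ε<gap (begin
    minP - minQ            ≤⟨ +-monoˡ-≤ (- minQ) minP≤ ⟩
    minQ + ε - minQ        ≈⟨ +-congʳ (+-comm minQ ε) ⟩
    ε + minQ - minQ        ≈⟨ x+y-y≈x ε minQ ⟩
    ε                      ∎)
    where
    open ≤-Reasoning
    minP = minimum (map (θ α) (filter P? (labellings k α)))
    minQ = minimum (map (θ α) (filter Q? (labellings k α)))
    min≤minQ : minOver K k (θ α) ≤ minQ
    min≤minQ = ≤minimum (∈-map⁺ (θ α) (∈-filter⁺ Q? (∈-labellings y) Qy))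
      (All.map⁺ (All.universal (λ z → minimum≤ (∈-map⁺ (θ α) (∈-labellings z))) _))
    minP≤ : minP ≤ minQ + ε
    minP≤ = begin
      minP                     ≤⟨ minimum≤ (∈-map⁺ (θ α) (∈-filter⁺ P? (∈-labellings x) Px)) ⟩
      θ α x                    ≤⟨ T-does⁻ (θ α x ≤? minOver K k (θ α) + ε) near ⟩
      minOver K k (θ α) + ε    ≤⟨ +-monoˡ-≤ ε min≤minQ ⟩
      minQ + ε                 ∎

  <-ε⇒ε<- : ∀ {x} → x < - ε → ε < - x
  <-ε⇒ε<- {x} x<-ε = ≰⇒> λ -x≤ε → <⇒≱ x<-ε
    (≤-trans (-‿anti-≤ -x≤ε) (≤-reflexive (⁻¹-involutive x)))

  module _ (π ρ : Partition) where

    private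
      u = proj₁ π
      v = proj₁ ρ

    fst : Labelling k (pair u v) → Bool
    fst x = side π (lookup x (first∈pair u v))

    snd : Labelling k (pair u v) → Bool
    snd x = side ρ (lookup x (second∈pair u v))

    same? : ∀ x → Dec (fst x ≡ snd x)
    same? x = fst x Bool.≟ snd x

    gap : Carrier
    gap = minimum (map (θ (pair u v)) (filter (¬? ∘ same?) (labellings k (pair u v))))
        - minimum (map (θ (pair u v)) (filter same? (labellings k (pair u v))))

    sides : u ≢ v → ∀ a b → ∃[ x ] fst x ≡ side π a × snd x ≡ side ρ b
    sides u≢v a b = tab f (pair u v) ,
      ≡.cong (side π) (≡.trans (lookup-tab f (first∈pair u v))
        (≡.trans (≔-minimal (zeros [ u ≔ a ]) b u≢v) (≔-updates zeros u a))) ,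
      ≡.cong (side ρ) (≡.trans (lookup-tab f (second∈pair u v)) (≔-updates (zeros [ u ≔ a ]) v b))
      where
      f = zeros [ u ≔ a ] [ v ≔ b ]

    positive-label : ∀ {σ} → σ ∈Π → ∃[ b ] side σ b ≡ true
    positive-label {σ} σ∈Π = σ∈Π .a , dec-true (σ∈Π .a ∈? proj₂ σ)
      (≡.subst (σ∈Π .a ∈_) (≡.sym (σ∈Π .π⁺≡⁅a⁆)) (x∈⁅x⁆ _))

    negative-label : ∀ {σ} → σ ∈Π → ∃[ b ] side σ b ≡ false
    negative-label {σ} σ∈Π = let b , b∈ = σ∈Π .π⁻-nonempty in b , dec-false (b ∈? proj₂ σ) (x∈∁p⇒x∉p b∈)

    -- The large gap leaves near-minimal pairs only in the cheaper class: opposite sides for a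
    -- negative edge, equal sides for a positive one. Both parts of the partitions being nonempty
    -- provides a member of that class.
    near-sides : π ∈Π → ρ ∈Π → u ≢ v → ε < ∣ gap ∣ₖ → (neg? : Dec (gap < - ε)) →
                 ∀ x → T (I₀ (pair u v) x) → snd x ≡ flip-if neg? (fst x)
    near-sides π∈Π ρ∈Π u≢v ε<∣gap∣ (yes gap<-ε) x near =
      let a , a⁻ = negative-label π∈Π
          b , b⁺ = positive-label ρ∈Π
          y , y₁ , y₂ = sides u≢v a b
      in Bool.¬-not (λ eq → near⇒¬ same? (¬? ∘ same?) {y}
           (λ y-same → false≢true (≡.trans (≡.sym (≡.trans y₁ a⁻)) (≡.trans y-same (≡.trans y₂ b⁺))))
           (<-≤-trans (<-ε⇒ε<- gap<-ε) (≤-reflexive (⁻¹-anti-homo‿- _ _))) near (≡.sym eq))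
      where
      false≢true : false ≢ true
      false≢true ()
    near-sides π∈Π ρ∈Π u≢v ε<∣gap∣ (no gap≮-ε) x near =
      let a , a⁺ = positive-label π∈Π
          b , b⁺ = positive-label ρ∈Π
          y , y₁ , y₂ = sides u≢v a b
      in ≡.sym (decidable-stable (same? x) (near⇒¬ (¬? ∘ same?) same? {y}
           (≡.trans y₁ (≡.trans a⁺ (≡.sym (≡.trans y₂ b⁺))))
           (<∣∣ₖ⇒ gap ε<∣gap∣ gap≮-ε) near))

    weight-sides : π ∈Π → ρ ∈Π → (edge? : Dec (Edge F (pair u v))) →
                   let weight = [_⇒_] K k edge? (λ _ → gap) in
                   ε < ∣ weight ∣ₖ → Edge F (pair u v) ×
                   (∀ (neg? : Dec (weight < - ε)) x → T (I₀ (pair u v) x) → snd x ≡ flip-if neg? (fst x))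
    weight-sides π∈Π ρ∈Π (yes edge) ε<∣gap∣ =
      edge , near-sides π∈Π ρ∈Π (edge-distinct (proj₂ edge)) ε<∣gap∣
    -- Without an edge the weight is zero, and its absolute value cannot exceed the positive `ε`.
    weight-sides π∈Π ρ∈Π (no _) ε<∣0∣ = contradiction
      (Extrema.max≤v⁺ totalOrder (<⇒≤ 0<ε) (≤-trans (≤-reflexive ε⁻¹≈ε) (<⇒≤ 0<ε) ∷ [])) (<⇒≱ ε<∣0∣)

    adjacent-sides : π ∈Π → ρ ∈Π → Adjacent (π , ρ) → Edge F (pair u v) ×
                     (∀ x → T (I₀ (pair u v) x) → snd x ≡ flip-if (negative? (π , ρ)) (fst x))
    adjacent-sides π∈Π ρ∈Π adj =
      let edge , relate = weight-sides π∈Π ρ∈Π (edge? F (pair u v)) adj in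
      edge , relate (negative? (π , ρ))

  module _ {I : CSP} (closed : ∀ o → ¬ Enabled I o)
           (near : ∀ {α x} → ∣ α ∣ ≡ 2 → T (I α x) → T (I₀ α x)) where

    Uniform : Partition → Bool → Set
    Uniform π b = ∀ a → Dom I (proj₁ π) a → side π a ≡ b

    -- A surviving pair is near-minimal and its label at the first node survives too, so the sign of
    -- the edge determines the side of its other label. A label on the wrong side thus has no
    -- support and could still be removed.
    uniform-step : ∀ {π ρ b} → π ∈Π → ρ ∈Π → Adjacent (π , ρ) →
                   Uniform π b → Uniform ρ (flip-if (negative? (π , ρ)) b)
    uniform-step {π} {ρ} {b} π∈Π ρ∈Π adj uniform c dom =
      let edge , relate = adjacent-sides π ρ π∈Π ρ∈Π adj in
      decidable-stable (side ρ c Bool.≟ flip-if (negative? (π , ρ)) b) λ ≢ →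
      closed (removeLabel _ _ c) (removeLabel edge dom λ x at-c rel →
        let dom-u = decidable-stable (T? _) λ ¬dom → closed (removePair _ _ x) (removePair edge rel ¬dom) in
        ≢ (≡.trans (≡.cong (side ρ) (≡.sym at-c))
          (≡.trans (relate x (near (proj₂ edge) rel))
            (≡.cong (flip-if (negative? (π , ρ))) (uniform _ dom-u)))))

    uniform-walk : ∀ π πs {ρ b} → All _∈Π (π ∷ πs) → ρ ∈Π → All Adjacent (zip (π ∷ πs) (πs ∷ʳ ρ)) →
                   Uniform π b → Uniform ρ (flips (length (filter negative? (zip (π ∷ πs) (πs ∷ʳ ρ)))) b)
    uniform-walk π [] {ρ} {b} (π∈Π ∷ []) ρ∈Π (adj ∷ []) uniform =
      ≡.subst (Uniform ρ) (flips-filter negative? (π , ρ) [] b) (uniform-step π∈Π ρ∈Π adj uniform)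
    uniform-walk π (π′ ∷ πs) {ρ} {b} (π∈Π ∷ π′∈Π ∷ πs∈Π) ρ∈Π (adj ∷ adjs) uniform =
      ≡.subst (Uniform ρ) (flips-filter negative? (π , π′) _ b)
        (uniform-walk π′ πs (π′∈Π ∷ πs∈Π) ρ∈Π adjs (uniform-step π∈Π π′∈Π adj uniform))

    -- The starting domain lies on the side of `s`; one turn around the cycle negates this side an
    -- odd number of times, so no label satisfies both.
    frustrated⇒empty : ∀ π πs {s} → All _∈Π (π ∷ πs) → All Adjacent (cyclicPairs (π ∷ πs)) →
                       length (filter negative? (cyclicPairs (π ∷ πs))) % 2 ≡ 1 →
                       (∀ {a} → Dom I (proj₁ π) a → a ≡ s) → EmptyAt I (proj₁ π)
    frustrated⇒empty π πs {s} ∈Π@(π∈Π ∷ _) adj odd only-s a dom = Bool.not-¬ {side π a}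
      (≡.cong (side π) (only-s dom))
      (≡.trans (uniform-walk π πs ∈Π π∈Π adj (λ a dom → ≡.cong (side π) (only-s dom)) a dom)
        (flips-odd (length (filter negative? (cyclicPairs (π ∷ πs)))) (side π s) odd))

  frustrated⇒≢[] : ∀ π πs → All _∈Π (π ∷ πs) → All Adjacent (cyclicPairs (π ∷ πs)) →
                   length (filter negative? (cyclicPairs (π ∷ πs))) % 2 ≡ 1 →
                   ∀ {os I} → Run I₀ os I → ∀ {s B} → Search I (proj₁ π) s B → B ≢ []
  frustrated⇒≢[] π πs ∈Π adj odd _ (inconsistent run empty _) = associated≢[] run empty
  frustrated⇒≢[] π πs ∈Π adj odd run₀ (consistent (_ , inj₁ incons) ¬incons) =
    contradiction incons ¬incons
  frustrated⇒≢[] π πs ∈Π adj odd {I = I} run₀ {s}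
    (consistent {I′ = I′} (run , inj₂ closed) ¬incons) =
    contradiction (proj₁ π , frustrated⇒empty closed near π πs ∈Π adj odd
      (λ dom → fix-unique {I} (proj₁ π) (run-shrinks run dom))) ¬incons
    where
    -- Fixing a label does not affect edge relations, so what survives there was near-minimal from
    -- the start.
    near : ∀ {α x} → ∣ α ∣ ≡ 2 → T (I′ α x) → T (I₀ α x)
    near ≡2 t = run-shrinks run₀ (fix-elsewhere {I} (proj₁ π) s (singleton≢edge ≡2 ∘ ≡.sym) (run-shrinks run t))

-- Processing order and output

module _ {c ℓ₁ ℓ₂} (K : OrderedField c ℓ₁ ℓ₂) {n : ℕ} (k : Fin n → ℕ)
         (F : List (Subset n)) (θ : Cost K k) (ε : OrderedField.Carrier K)
         (run : FindTriplets K k F θ ε) where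

  open FindTriplets run
  open ArcConsistency k F
  open DecTotalOrder ≼-decTotalOrder using (totalOrder; antisym)
    renaming (refl to ≼-refl; trans to ≼-trans)
  open Sort ≼-decTotalOrder using (sort; sort-↗; sort-↭)
  open Sorted totalOrder using (Sorted)

  collect-⊇ : ∀ A rs {τ} → τ ∈ˢ A → τ ∈ˢ collect A rs
  collect-⊇ A []       τ∈A = τ∈A
  collect-⊇ A (r ∷ rs) τ∈A with all? (λ τ → ¬? (τ ∈ˢ? A)) (𝓐ᵣ r)
  ... | yes _ = collect-⊇ (A ++ 𝓐ᵣ r) rs (∈-++⁺ˡ τ∈A)
  ... | no  _ = collect-⊇ A rs τ∈A

  -- Nothing has been collected before the first node, so its disjointness test succeeds.
  collect-first : ∀ r rs {τ} → τ ∈ˢ 𝓐ᵣ r → τ ∈ˢ collect [] (r ∷ rs)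
  collect-first r rs τ∈𝓐ᵣ with all? (λ τ → ¬? (τ ∈ˢ? [])) (𝓐ᵣ r)
  ... | yes _   = collect-⊇ (𝓐ᵣ r) rs τ∈𝓐ᵣ
  ... | no  ¬all = contradiction (All.universal (λ _ ()) (𝓐ᵣ r)) ¬all

  first : ∀ {rs r} → Sorted rs → r ∈ˢ rs →
          ∃[ r₁ ] (∀ {r} → r ∈ˢ rs → r₁ ≼ r) × (∀ {τ} → τ ∈ˢ 𝓐ᵣ r₁ → τ ∈ˢ collect [] rs)
  first {r₁ ∷ rs} sorted _ with Linked.Linked⇒AllPairs ≼-trans sorted
  ... | r₁≼ ∷ _ =
    r₁ , (λ { (here ≡.refl) → ≼-refl ; (there r∈rs) → All.lookup r₁≼ r∈rs }) , collect-first r₁ rs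

  -- Fullness only asserts negations about labels in the domain, so it is stable under double
  -- negation; this permits the argument by contradiction in `first-full`.
  Full-stable : ∀ {r} → ¬ ¬ Full r → Full r
  Full-stable ¬¬full = proj₁ , λ y → y , λ 𝓐≡[] → ¬¬full λ full → proj₂ (proj₂ full y) 𝓐≡[]

  ∈-sorted : ∀ r → r ∈ˢ sort (allFin n)
  ∈-sorted r = ∈-resp-↭ (↭-sym (sort-↭ (allFin n))) (∈-allFin r)

  -- `Rule₁` puts full nodes strictly before all others, so the least node is full as soon as some
  -- node is.
  first-full : ∀ {r} → Full r → ∃[ r₁ ] Full r₁ × (∀ {τ} → τ ∈ˢ 𝓐ᵣ r₁ → τ ∈ˢ output)
  first-full {r} full with first (sort-↗ (allFin n)) (∈-sorted r)
  ... | r₁ , r₁≼ , ⊆output = r₁ , Full-stable ¬¬full₁ , ⊆output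
    where
    ¬¬full₁ : ¬ ¬ Full r₁
    ¬¬full₁ ¬full₁ =
      let r≼r₁ , r≢r₁ = respects (inj₁ (full , ¬full₁))
      in r≢r₁ (antisym r≼r₁ (r₁≼ (∈-sorted r)))

  ∈-𝓐ᵣ : ∀ {r s τ} → 𝓨 r s → τ ∈ˢ 𝓐 r s → τ ∈ˢ 𝓐ᵣ r
  ∈-𝓐ᵣ {r} {s} y τ∈𝓐 = ∈-concatMap⁺ (𝓐 r)
    (Any.map (λ { ≡.refl → τ∈𝓐 }) (∈-filter⁺ (λ a → T? (I ⁅ r ⁆ (single r a))) (∈-allFin s) y))

theorem6 : ∀ {c ℓ₁ ℓ₂} (K : OrderedField c ℓ₁ ℓ₂) →
    let open OrderedField K in
    ∀ {n : ℕ} (k : Fin n → ℕ) (F : List (Subset n)) → IsFactorSet F →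
    ∀ (θ : Cost K k) (ε : Carrier) → 0# < ε →
    PartitionGraph.FrustratedCycle K k F θ ε →
    ∀ (run : FindTriplets K k F θ ε) →
    let open FindTriplets run in
    (∃[ r ] 𝓛 r ≐ 𝓨 r)
    × (∃[ θ̄ ] IsReparameterization K k (addTriplets F output) (extendByZero K k F θ) θ̄
    × Φ K k F θ < Φ K k (addTriplets F output) θ̄)
theorem6 K {n} k F isFactorSet θ ε 0<ε cycle run = node vertices length≥3 inΠ edges odd
  where
  open OrderedField K using (_<_)
  open PartitionGraph K k F θ ε
  open FrustratedCycle cycle
  open FindTriplets run
  open FrustratedCycleProperties K k F θ ε 0<ε using (frustrated⇒≢[])
  -- The vertex list is generalized so that it can be split; the length bound rules out the empty
  -- list.
  node : ∀ πs → 3 ℕ.≤ length πs → All _∈Π πs → All Adjacent (cyclicPairs πs) →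
         length (filter negative? (cyclicPairs πs)) % 2 ≡ 1 → _
  node (π ∷ πs) _ ∈Π adj odd =
    let full : Full (proj₁ π)
        full = proj₁ , λ {s} y →
          y , frustrated⇒≢[] π πs ∈Π adj odd (proj₁ runAC) (search (proj₁ π) s y)
        -- The node whose minimum is raised is the first in the order, which may differ from the
        -- node of `π`.
        r , (_ , full-r) , ⊆output = first-full K k F θ ε run {proj₁ π} full
    in (proj₁ π , full) ,
       Refutation.increase K k F isFactorSet output θ ε 0<ε (proj₁ runAC) {r}
         λ s y → 𝓐 r s , search r s y , proj₂ (full-r y) , ⊆output ∘ ∈-𝓐ᵣ K k F θ ε run y
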